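{- For all integers $n \geq 1$ and all real $x$, $$B_{n}(x) = x^n - n \sum_{m=1}^n \frac{c_{m}}{m} \genfrac{\{}{\}}{0pt}{}{n-1}{m-1}_x$$ and $$B_{n}(x) = (x-1)^n - n \sum_{m=1}^n \frac{\widehat{c}_{m}}{m} \genfrac{\{}{\}}{0pt}{}{n-1}{m-1}_x.$$
   Context: For real $z$ and integer $n\ge 0$, $\binom{z}{n} = \frac{z(z-1)\cdots(z-n+1)}{n!}$. The Cauchy numbers of the first and second kind are $c_n = n! \int_{0}^{1} \binom{t}{n}\, dt$ and $\widehat{c}_n = n! \int_{0}^{1} \binom{ - t}{n}\, dt$, $n \ge 0$. $B_n(x)$ are the classical Bernoulli polynomials, $\frac{te^{xt}}{e^t-1}=\sum_{n\ge0}B_n(x)\frac{t^n}{n!}$. The generalized Stirling numbers of the second kind are $\genfrac{\{}{\}}{0pt}{}{n}{m}_x = \sum_{i=0}^{n-m} \binom{n}{i}\genfrac{\{}{\}}{0pt}{}{n-i}{m} x^i$ for $0 \leq m \leq n$ and $x\in\mathbb{R}$, where $\genfrac{\{}{\}}{0pt}{}{n}{m}$ are the ordinary Stirling numbers of the second kind and $x^0=1$. -}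

module Defs where

open import Algebra.Bundles using (CommutativeRing)
open import Algebra.Structures using (IsCommutativeRing)
open import Data.Fin.Base using (Fin; zero; suc; toℕ; inject₁; fromℕ)
open import Data.Integer.Base using (+_)
open import Data.Nat.Base as ℕ using (ℕ; zero; suc; _∸_; _!; NonZero)
import Data.Nat.Properties as ℕ
open import Data.Nat.Combinatorics using (_C_)
open import Data.Product.Base using (Σ-syntax; ∃-syntax; _×_; _,_; proj₁; proj₂)
open import Data.Rational.Base as ℚ using (ℚ; 0ℚ; 1ℚ; ½)
import Data.Rational.Properties as ℚ
open import Data.Rational.Solver using (module +-*-Solver)
open import Data.Sum.Base using (inj₁; inj₂)
open import Level using (0ℓ)
open import Relation.Binary.Structures using (IsEquivalence)
open import Relation.Binary.PropositionalEquality as ≡ using (_≡_)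

-- Cantor's real numbers: Cauchy sequences of rationals, identified when
-- their difference tends to zero.

Cauchy : (ℕ → ℚ) → Set
Cauchy s = ∀ ε → 0ℚ ℚ.< ε →
  ∃[ N ] (∀ m n → N ℕ.≤ m → N ℕ.≤ n → ℚ.∣ s m ℚ.- s n ∣ ℚ.≤ ε)

Null : (ℕ → ℚ) → Set
Null s = ∀ ε → 0ℚ ℚ.< ε → ∃[ N ] (∀ n → N ℕ.≤ n → ℚ.∣ s n ∣ ℚ.≤ ε)

record ℝ : Set where
  constructor mkℝ
  field
    seq    : ℕ → ℚ
    cauchy : Cauchy seq

open ℝ public

infix 4 _≈_ _≤_

-- A record rather than a synonym, so that x and y can be inferred from
-- a proof of x ≈ y.
record _≈_ (x y : ℝ) : Set where
  constructor mk≈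
  field
    null : Null (λ n → seq x n ℚ.- seq y n)

open _≈_ public

_≤_ : ℝ → ℝ → Set
x ≤ y = ∀ ε → 0ℚ ℚ.< ε → ∃[ N ] (∀ n → N ℕ.≤ n → seq x n ℚ.≤ seq y n ℚ.+ ε)

private
  open +-*-Solver using (solve; _:+_; _:*_; :-_; _:-_; _:=_)

  *-diff : ∀ a b c d → a ℚ.* (c ℚ.- d) ℚ.+ d ℚ.* (a ℚ.- b) ≡ a ℚ.* c ℚ.- b ℚ.* d
  *-diff = solve 4 (λ a b c d → a :* (c :- d) :+ d :* (a :- b) := a :* c :- b :* d) ≡.refl

  +-diff : ∀ a b c d → (a ℚ.- b) ℚ.+ (c ℚ.- d) ≡ (a ℚ.+ c) ℚ.- (b ℚ.+ d)
  +-diff = solve 4 (λ a b c d → (a :- b) :+ (c :- d) := (a :+ c) :- (b :+ d)) ≡.refl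

  half>0 : ∀ {ε} → 0ℚ ℚ.< ε → 0ℚ ℚ.< ½ ℚ.* ε
  half>0 {ε} 0<ε = ≡.subst (ℚ._< ½ ℚ.* ε) (ℚ.*-zeroʳ ½) (ℚ.*-monoʳ-<-pos ½ 0<ε)

  half+half : ∀ ε → ½ ℚ.* ε ℚ.+ ½ ℚ.* ε ≡ ε
  half+half ε = ≡.trans (≡.sym (ℚ.*-distribʳ-+ ε ½ ½)) (ℚ.*-identityˡ ε)

  ∣+∣≤ : ∀ {ε} a b → ℚ.∣ a ∣ ℚ.≤ ½ ℚ.* ε → ℚ.∣ b ∣ ℚ.≤ ½ ℚ.* ε → ℚ.∣ a ℚ.+ b ∣ ℚ.≤ ε
  ∣+∣≤ {ε} a b p q = ℚ.≤-trans (ℚ.∣p+q∣≤∣p∣+∣q∣ a b)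
    (ℚ.≤-trans (ℚ.+-mono-≤ p q) (ℚ.≤-reflexive (half+half ε)))

  div : ℚ → (K : ℚ) → 0ℚ ℚ.< K → ℚ
  div ε K 0<K = (ℚ.1/ K) {{ℚ.pos⇒nonZero K {{ℚ.positive 0<K}}}} ℚ.* ε

  *-div : ∀ ε K (0<K : 0ℚ ℚ.< K) → K ℚ.* div ε K 0<K ≡ ε
  *-div ε K 0<K = ≡.trans (≡.sym (ℚ.*-assoc K _ ε))
    (≡.trans (≡.cong (ℚ._* ε) (ℚ.*-inverseʳ K {{nz}})) (ℚ.*-identityˡ ε))
    where nz = ℚ.pos⇒nonZero K {{ℚ.positive 0<K}}

  div>0 : ∀ {ε} K (0<K : 0ℚ ℚ.< K) → 0ℚ ℚ.< ε → 0ℚ ℚ.< div ε K 0<K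
  div>0 {ε} K 0<K 0<ε = ℚ.positive⁻¹ (div ε K 0<K)
    {{ℚ.pos*pos⇒pos 1/K {{ℚ.1/pos⇒pos K {{ℚ.positive 0<K}}}} ε {{ℚ.positive 0<ε}}}}
    where 1/K = (ℚ.1/ K) {{ℚ.pos⇒nonZero K {{ℚ.positive 0<K}}}}

  ∣*∣≤ : ∀ {ε} a b K (0<K : 0ℚ ℚ.< K) →
         ℚ.∣ a ∣ ℚ.≤ K → ℚ.∣ b ∣ ℚ.≤ div ε K 0<K → ℚ.∣ a ℚ.* b ∣ ℚ.≤ ε
  ∣*∣≤ {ε} a b K 0<K p q = begin
    ℚ.∣ a ℚ.* b ∣         ≡⟨ ℚ.∣p*q∣≡∣p∣*∣q∣ a b ⟩
    ℚ.∣ a ∣ ℚ.* ℚ.∣ b ∣   ≤⟨ ℚ.*-monoʳ-≤-nonNeg ℚ.∣ b ∣ {{ℚ.∣-∣-nonNeg b}} p ⟩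
    K ℚ.* ℚ.∣ b ∣         ≤⟨ ℚ.*-monoˡ-≤-nonNeg K {{ℚ.nonNegative (ℚ.<⇒≤ 0<K)}} q ⟩
    K ℚ.* div ε K 0<K     ≡⟨ *-div ε K 0<K ⟩
    ε                     ∎
    where open ℚ.≤-Reasoning

  ∣a∣-∣b∣≤∣a-b∣ : ∀ a b → ℚ.∣ a ∣ ℚ.- ℚ.∣ b ∣ ℚ.≤ ℚ.∣ a ℚ.- b ∣
  ∣a∣-∣b∣≤∣a-b∣ a b = begin
    ℚ.∣ a ∣ ℚ.- ℚ.∣ b ∣                      ≡⟨ ≡.cong (λ d → ℚ.∣ d ∣ ℚ.- ℚ.∣ b ∣) (solve 2 (λ a b → a := (a :- b) :+ b) ≡.refl a b) ⟩
    ℚ.∣ (a ℚ.- b) ℚ.+ b ∣ ℚ.- ℚ.∣ b ∣        ≤⟨ ℚ.+-monoˡ-≤ (ℚ.- ℚ.∣ b ∣) (ℚ.∣p+q∣≤∣p∣+∣q∣ (a ℚ.- b) b) ⟩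
    (ℚ.∣ a ℚ.- b ∣ ℚ.+ ℚ.∣ b ∣) ℚ.- ℚ.∣ b ∣  ≡⟨ solve 2 (λ d b → (d :+ b) :- b := d) ≡.refl ℚ.∣ a ℚ.- b ∣ ℚ.∣ b ∣ ⟩
    ℚ.∣ a ℚ.- b ∣                            ∎
    where open ℚ.≤-Reasoning

  ∣∣a∣-∣b∣∣≤∣a-b∣ : ∀ a b → ℚ.∣ ℚ.∣ a ∣ ℚ.- ℚ.∣ b ∣ ∣ ℚ.≤ ℚ.∣ a ℚ.- b ∣
  ∣∣a∣-∣b∣∣≤∣a-b∣ a b with ℚ.∣p∣≡p∨∣p∣≡-p (ℚ.∣ a ∣ ℚ.- ℚ.∣ b ∣)
  ... | inj₁ e = ≡.subst (ℚ._≤ ℚ.∣ a ℚ.- b ∣) (≡.sym e) (∣a∣-∣b∣≤∣a-b∣ a b)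
  ... | inj₂ e = ≡.subst₂ ℚ._≤_
    (≡.trans (neg-sub ℚ.∣ a ∣ ℚ.∣ b ∣) (≡.sym e))
    (≡.trans (≡.cong ℚ.∣_∣ (neg-sub a b)) (ℚ.∣-p∣≡∣p∣ (a ℚ.- b)))
    (∣a∣-∣b∣≤∣a-b∣ b a)
    where
    neg-sub : ∀ p q → q ℚ.- p ≡ ℚ.- (p ℚ.- q)
    neg-sub = solve 2 (λ p q → q :- p := :- (p :- q)) ≡.refl

  ⊔≤ˡ : ∀ M N {n} → M ℕ.⊔ N ℕ.≤ n → M ℕ.≤ n
  ⊔≤ˡ M N = ℕ.≤-trans (ℕ.m≤m⊔n M N)

  ⊔≤ʳ : ∀ M N {n} → M ℕ.⊔ N ℕ.≤ n → N ℕ.≤ n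
  ⊔≤ʳ M N = ℕ.≤-trans (ℕ.m≤n⊔m M N)

Bounded : (ℕ → ℚ) → Set
Bounded s = Σ[ K ∈ ℚ ] (0ℚ ℚ.< K × (∃[ N ] (∀ n → N ℕ.≤ n → ℚ.∣ s n ∣ ℚ.≤ K)))

bounded : ∀ x → Bounded (seq x)
bounded x with cauchy x 1ℚ (ℚ.positive⁻¹ 1ℚ)
... | N , p = K , 0<K , N , below
  where
  K = 1ℚ ℚ.+ ℚ.∣ seq x N ∣
  0<K : 0ℚ ℚ.< K
  0<K = ℚ.+-mono-<-≤ {0ℚ} {1ℚ} (ℚ.positive⁻¹ 1ℚ) (ℚ.0≤∣p∣ (seq x N))
  below : ∀ n → N ℕ.≤ n → ℚ.∣ seq x n ∣ ℚ.≤ K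
  below n N≤n = begin
    ℚ.∣ seq x n ∣                                ≡⟨ ≡.cong ℚ.∣_∣ (solve 2 (λ a b → a := (a :- b) :+ b) ≡.refl (seq x n) (seq x N)) ⟩
    ℚ.∣ (seq x n ℚ.- seq x N) ℚ.+ seq x N ∣      ≤⟨ ℚ.∣p+q∣≤∣p∣+∣q∣ (seq x n ℚ.- seq x N) (seq x N) ⟩
    ℚ.∣ seq x n ℚ.- seq x N ∣ ℚ.+ ℚ.∣ seq x N ∣  ≤⟨ ℚ.+-monoˡ-≤ ℚ.∣ seq x N ∣ (p n N N≤n ℕ.≤-refl) ⟩
    K                                            ∎
    where open ℚ.≤-Reasoning

null-+ : ∀ {s t} → Null s → Null t → Null (λ n → s n ℚ.+ t n)
null-+ {s} {t} p q ε 0<ε with p (½ ℚ.* ε) (half>0 0<ε) | q (½ ℚ.* ε) (half>0 0<ε)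
... | M , p′ | N , q′ = M ℕ.⊔ N , λ n n≥ →
  ∣+∣≤ (s n) (t n) (p′ n (⊔≤ˡ M N n≥)) (q′ n (⊔≤ʳ M N n≥))

null-* : ∀ {s t} → Bounded s → Null t → Null (λ n → s n ℚ.* t n)
null-* {s} {t} (K , 0<K , M , p) q ε 0<ε with q (div ε K 0<K) (div>0 K 0<K 0<ε)
... | N , q′ = M ℕ.⊔ N , λ n n≥ →
  ∣*∣≤ (s n) (t n) K 0<K (p n (⊔≤ˡ M N n≥)) (q′ n (⊔≤ʳ M N n≥))

null-neg : ∀ {s} → Null s → Null (λ n → ℚ.- s n)
null-neg {s} p ε 0<ε with p ε 0<ε
... | N , p′ = N , λ n n≥ → ≡.subst (ℚ._≤ ε) (≡.sym (ℚ.∣-p∣≡∣p∣ (s n))) (p′ n n≥)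

null-resp : ∀ {s t} → (∀ n → s n ≡ t n) → Null s → Null t
null-resp e p ε 0<ε with p ε 0<ε
... | N , p′ = N , λ n n≥ → ≡.subst (λ a → ℚ.∣ a ∣ ℚ.≤ ε) (e n) (p′ n n≥)

null-0 : ∀ {s} → (∀ n → s n ≡ 0ℚ) → Null s
null-0 e ε 0<ε = 0 , λ n _ → ≡.subst (λ a → ℚ.∣ a ∣ ℚ.≤ ε) (≡.sym (e n)) (ℚ.<⇒≤ 0<ε)

≡⇒≈ : ∀ {x y} → (∀ n → seq x n ≡ seq y n) → x ≈ y
≡⇒≈ {x} {y} e = mk≈ (null-0 λ n →
  ≡.trans (≡.cong (ℚ._- seq y n) (e n)) (ℚ.+-inverseʳ (seq y n)))

≈-isEquivalence : IsEquivalence _≈_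
≈-isEquivalence = record
  { refl  = ≡⇒≈ (λ _ → ≡.refl)
  ; sym   = λ {x} {y} p → mk≈ (null-resp
      (λ n → solve 2 (λ a b → :- (a :- b) := b :- a) ≡.refl (seq x n) (seq y n))
      (null-neg (null p)))
  ; trans = λ {x} {y} {z} p q → mk≈ (null-resp
      (λ n → solve 3 (λ a b c → (a :- b) :+ (b :- c) := a :- c) ≡.refl
        (seq x n) (seq y n) (seq z n))
      (null-+ (null p) (null q)))
  }

fromℚ : ℚ → ℝ
fromℚ q = mkℝ (λ _ → q) λ ε 0<ε → 0 , λ _ _ _ _ →
  ≡.subst (λ a → ℚ.∣ a ∣ ℚ.≤ ε) (≡.sym (ℚ.+-inverseʳ q)) (ℚ.<⇒≤ 0<ε)

fromNat : ℕ → ℝ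
fromNat n = fromℚ (+ n ℚ./ 1)

0ℝ 1ℝ : ℝ
0ℝ = fromℚ 0ℚ
1ℝ = fromℚ 1ℚ

infixl 6 _+_ _-_
infixl 7 _*_ _/_
infix  8 -_

_+_ : ℝ → ℝ → ℝ
x + y = mkℝ (λ n → seq x n ℚ.+ seq y n) +-cauchy
  where
  +-cauchy : Cauchy (λ n → seq x n ℚ.+ seq y n)
  +-cauchy ε 0<ε with cauchy x (½ ℚ.* ε) (half>0 0<ε) | cauchy y (½ ℚ.* ε) (half>0 0<ε)
  ... | M , p | N , q = M ℕ.⊔ N , λ m n m≥ n≥ →
    ≡.subst (λ a → ℚ.∣ a ∣ ℚ.≤ ε)
      (+-diff (seq x m) (seq x n) (seq y m) (seq y n))
      (∣+∣≤ (seq x m ℚ.- seq x n) (seq y m ℚ.- seq y n)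
        (p m n (⊔≤ˡ M N m≥) (⊔≤ˡ M N n≥)) (q m n (⊔≤ʳ M N m≥) (⊔≤ʳ M N n≥)))

-_ : ℝ → ℝ
- x = mkℝ (λ n → ℚ.- seq x n) neg-cauchy
  where
  neg-cauchy : Cauchy (λ n → ℚ.- seq x n)
  neg-cauchy ε 0<ε with cauchy x ε 0<ε
  ... | N , p = N , λ m n m≥ n≥ →
    ≡.subst (λ a → ℚ.∣ a ∣ ℚ.≤ ε)
      (solve 2 (λ a b → b :- a := (:- a) :- (:- b)) ≡.refl (seq x m) (seq x n))
      (p n m n≥ m≥)

_*_ : ℝ → ℝ → ℝ
x * y = mkℝ (λ n → seq x n ℚ.* seq y n) *-cauchy
  where
  *-cauchy : Cauchy (λ n → seq x n ℚ.* seq y n)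
  *-cauchy ε 0<ε = M ℕ.⊔ N , close
    where
    bx = bounded x
    by = bounded y
    K = proj₁ bx
    L = proj₁ by
    0<K = proj₁ (proj₂ bx)
    0<L = proj₁ (proj₂ by)
    M₁ = proj₁ (proj₂ (proj₂ bx))
    M₂ = proj₁ (proj₂ (proj₂ by))
    M  = M₁ ℕ.⊔ M₂
    cx = cauchy x (div (½ ℚ.* ε) L 0<L) (div>0 L 0<L (half>0 0<ε))
    cy = cauchy y (div (½ ℚ.* ε) K 0<K) (div>0 K 0<K (half>0 0<ε))
    N₁ = proj₁ cx
    N₂ = proj₁ cy
    N  = N₁ ℕ.⊔ N₂
    close : ∀ m n → M ℕ.⊔ N ℕ.≤ m → M ℕ.⊔ N ℕ.≤ n →
            ℚ.∣ seq x m ℚ.* seq y m ℚ.- seq x n ℚ.* seq y n ∣ ℚ.≤ ε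
    close m n m≥ n≥ = ≡.subst (λ a → ℚ.∣ a ∣ ℚ.≤ ε)
      (*-diff (seq x m) (seq x n) (seq y m) (seq y n))
      (∣+∣≤ (seq x m ℚ.* (seq y m ℚ.- seq y n)) (seq y n ℚ.* (seq x m ℚ.- seq x n))
        (∣*∣≤ (seq x m) (seq y m ℚ.- seq y n) K 0<K
          (proj₂ (proj₂ (proj₂ bx)) m (⊔≤ˡ M₁ M₂ (⊔≤ˡ M N m≥)))
          (proj₂ cy m n (⊔≤ʳ N₁ N₂ (⊔≤ʳ M N m≥)) (⊔≤ʳ N₁ N₂ (⊔≤ʳ M N n≥))))
        (∣*∣≤ (seq y n) (seq x m ℚ.- seq x n) L 0<L
          (proj₂ (proj₂ (proj₂ by)) n (⊔≤ʳ M₁ M₂ (⊔≤ˡ M N n≥)))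
          (proj₂ cx m n (⊔≤ˡ N₁ N₂ (⊔≤ʳ M N m≥)) (⊔≤ˡ N₁ N₂ (⊔≤ʳ M N n≥)))))

_-_ : ℝ → ℝ → ℝ
x - y = x + - y

_/_ : ℝ → (n : ℕ) .{{_ : NonZero n}} → ℝ
x / n = x * fromℚ (+ 1 ℚ./ n)

∣_∣ : ℝ → ℝ
∣ x ∣ = mkℝ (λ n → ℚ.∣ seq x n ∣) abs-cauchy
  where
  abs-cauchy : Cauchy (λ n → ℚ.∣ seq x n ∣)
  abs-cauchy ε 0<ε with cauchy x ε 0<ε
  ... | N , p = N , λ m n m≥ n≥ →
    ℚ.≤-trans (∣∣a∣-∣b∣∣≤∣a-b∣ (seq x m) (seq x n)) (p m n m≥ n≥)

+-*-isCommutativeRing : IsCommutativeRing _≈_ _+_ _*_ -_ 0ℝ 1ℝ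
+-*-isCommutativeRing = record
  { isRing = record
    { +-isAbelianGroup = record
      { isGroup = record
        { isMonoid = record
          { isSemigroup = record
            { isMagma = record
              { isEquivalence = ≈-isEquivalence
              ; ∙-cong = λ {x} {y} {u} {v} p q → mk≈ (null-resp
                  (λ n → +-diff (seq x n) (seq y n) (seq u n) (seq v n))
                  (null-+ (null p) (null q)))
              }
            ; assoc = λ x y z → ≡⇒≈ (λ n → ℚ.+-assoc (seq x n) (seq y n) (seq z n))
            }
          ; identity = (λ x → ≡⇒≈ (λ n → ℚ.+-identityˡ (seq x n)))
                     , (λ x → ≡⇒≈ (λ n → ℚ.+-identityʳ (seq x n)))
          }
        ; inverse = (λ x → ≡⇒≈ (λ n → ℚ.+-inverseˡ (seq x n)))
                  , (λ x → ≡⇒≈ (λ n → ℚ.+-inverseʳ (seq x n)))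
        ; ⁻¹-cong = λ {x} {y} p → mk≈ (null-resp
            (λ n → solve 2 (λ a b → :- (a :- b) := (:- a) :- (:- b)) ≡.refl (seq x n) (seq y n))
            (null-neg (null p)))
        }
      ; comm = λ x y → ≡⇒≈ (λ n → ℚ.+-comm (seq x n) (seq y n))
      }
    ; *-cong = λ {x} {y} {u} {v} p q → mk≈ (null-resp
        (λ n → *-diff (seq x n) (seq y n) (seq u n) (seq v n))
        (null-+ (null-* (bounded x) (null q)) (null-* (bounded v) (null p))))
    ; *-assoc = λ x y z → ≡⇒≈ (λ n → ℚ.*-assoc (seq x n) (seq y n) (seq z n))
    ; *-identity = (λ x → ≡⇒≈ (λ n → ℚ.*-identityˡ (seq x n)))
                 , (λ x → ≡⇒≈ (λ n → ℚ.*-identityʳ (seq x n)))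
    ; distrib = (λ x y z → ≡⇒≈ (λ n → ℚ.*-distribˡ-+ (seq x n) (seq y n) (seq z n)))
              , (λ x y z → ≡⇒≈ (λ n → ℚ.*-distribʳ-+ (seq x n) (seq y n) (seq z n)))
    }
  ; *-comm = λ x y → ≡⇒≈ (λ n → ℚ.*-comm (seq x n) (seq y n))
  }

+-*-commutativeRing : CommutativeRing 0ℓ 0ℓ
+-*-commutativeRing = record { isCommutativeRing = +-*-isCommutativeRing }

open CommutativeRing +-*-commutativeRing public using (semiring)
open import Algebra.Properties.Semiring.Sum semiring public using (sum; sum-syntax; sum⁺-syntax)
open import Algebra.Properties.Semiring.Exp semiring public using (_^_)

Σ₁ : (n : ℕ) → ((m : ℕ) .{{_ : NonZero m}} → ℝ) → ℝ
Σ₁ n f = ∑[ i < n ] f (suc (toℕ i))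

syntax Σ₁ n (λ m → e) = ∑[1≤ m ≤ n ] e

record TaggedPartition (a b : ℝ) : Set where
  field
    size   : ℕ
    point  : Fin (suc size) → ℝ
    tag    : Fin size → ℝ
    start  : point zero ≈ a
    end    : point (fromℕ size) ≈ b
    lower  : ∀ i → point (inject₁ i) ≤ tag i
    upper  : ∀ i → tag i ≤ point (suc i)

  width : Fin size → ℝ
  width i = point (suc i) - point (inject₁ i)

  riemannSum : (ℝ → ℝ) → ℝ
  riemannSum f = ∑[ i < size ] (f (tag i) * width i)

  MeshAtMost : ℚ → Set
  MeshAtMost δ = ∀ i → width i ≤ fromℚ δ

open TaggedPartition public

IsIntegral : (a b : ℝ) → (ℝ → ℝ) → ℝ → Set
IsIntegral a b f I = ∀ ε → 0ℚ ℚ.< ε → Σ[ δ ∈ ℚ ] (0ℚ ℚ.< δ ×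
  ((P : TaggedPartition a b) → MeshAtMost P δ → ∣ riemannSum P f - I ∣ ≤ fromℚ ε))

falling : ℝ → ℕ → ℝ
falling z zero    = 1ℝ
falling z (suc n) = falling z n * (z - fromNat n)

binomial : ℝ → ℕ → ℝ
binomial z n = _/_ (falling z n) (n !) {{n ℕ.!≢0}}

AreCauchyNumbers₁ : (ℕ → ℝ) → Set
AreCauchyNumbers₁ c = ∀ n → ∃[ I ]
  (IsIntegral 0ℝ 1ℝ (λ t → binomial t n) I × c n ≈ fromNat (n !) * I)

AreCauchyNumbers₂ : (ℕ → ℝ) → Set
AreCauchyNumbers₂ c = ∀ n → ∃[ I ]
  (IsIntegral 0ℝ 1ℝ (λ t → binomial (- t) n) I × c n ≈ fromNat (n !) * I)

-- The generating function of the Bernoulli polynomials is read as a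
-- formal power series in t.

PowerSeries : Set
PowerSeries = ℕ → ℝ

infixl 7 _⊛_
infixl 6 _⊖_

_⊛_ : PowerSeries → PowerSeries → PowerSeries
(f ⊛ g) n = ∑[ i ≤ n ] (f (toℕ i) * g (n ∸ toℕ i))

_⊖_ : PowerSeries → PowerSeries → PowerSeries
(f ⊖ g) n = f n - g n

one : PowerSeries
one zero    = 1ℝ
one (suc _) = 0ℝ

var : PowerSeries
var 1 = 1ℝ
var _ = 0ℝ

egf : (ℕ → ℝ) → PowerSeries
egf a n = _/_ (a n) (n !) {{n ℕ.!≢0}}

exp : ℝ → PowerSeries
exp x = egf (x ^_)

-- The series e^t − 1 has no multiplicative inverse, so the quotient
-- t e^(xt) / (e^t − 1) is read as the series whose product with
-- e^t − 1 is t e^(xt); it is unique because the leading coefficient of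
-- e^t − 1 is a unit.
AreBernoulliPolynomials : (ℕ → ℝ → ℝ) → Set
AreBernoulliPolynomials B = ∀ x n →
  (egf (λ k → B k x) ⊛ (exp 1ℝ ⊖ one)) n ≈ (var ⊛ exp x) n

stirling₂ : ℕ → ℕ → ℕ
stirling₂ zero    zero    = 1
stirling₂ zero    (suc m) = 0
stirling₂ (suc n) zero    = 0
stirling₂ (suc n) (suc m) = suc m ℕ.* stirling₂ n (suc m) ℕ.+ stirling₂ n m

-- Meaningful for m ≤ n only, because of the truncated subtraction.
generalizedStirling₂ : ℕ → ℕ → ℝ → ℝ
generalizedStirling₂ n m x = ∑[ i ≤ n ∸ m ]
  (fromNat ((n C toℕ i) ℕ.* stirling₂ (n ∸ toℕ i) m) * x ^ toℕ i)

{-# OPTIONS --safe #-}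

-- By the binomial theorem the generalized Stirling numbers with parameter x
-- expand (x + t)ⁿ⁻¹ in falling factorials of t, so summing in t shows that
--   n ∑ₘ {n-1, m-1}ₓ t(t - 1)⋯(t - m + 1) / m = Bₙ(x + t) - Bₙ(x).
-- Integrating over t from 0 to 1, or with -t in place of t, gives the two
-- formulas, since the integral of Bₙ over [x + y, x + y + 1] is (x + y)ⁿ.
-- On the level of sequences these are identities between binomial
-- convolutions, and integration enters only through ∑ₘ S(k, m) cₘ = ∫ tᵏ,
-- whose two sides are limits of the same left Riemann sums at rational points.

module Submission where

open import Algebra.Bundles using (CommutativeRing; CommutativeSemiring; Semiring; SemiringWithoutAnnihilatingZero)
open import Algebra.Core using (Op₁; Op₂)
import Algebra.Definitions.RawSemiring as RawSemiring
open import Algebra.Structures using (IsCommutativeRing)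
open import Data.Empty using (⊥-elim)
open import Data.Fin.Base using (Fin; zero; suc; toℕ)
open import Data.Fin.Properties using (toℕ<n; toℕ-inject₁; toℕ-fromℕ)
open import Data.Integer.Base as ℤ using (+_)
import Data.Integer.Solver as ℤSolver
open import Data.Nat.Base as ℕ using (ℕ; zero; suc; _∸_; _!; NonZero)
open import Data.Nat.Combinatorics using (_C_; nCk+nC[k+1]≡[n+1]C[k+1]; k![n∸k]!∣n!)
open import Data.Nat.Combinatorics.Specification using (k>n⇒nCk≡0; nCk≡n!/k![n-k]!)
open import Data.Nat.DivMod using (m/n*n≡m)
import Data.Nat.Properties as ℕ
import Data.Nat.Solver as ℕSolver
open import Data.Product.Base using (∃-syntax; _×_; _,_; proj₁; proj₂)
open import Data.Rational.Base as ℚ using (ℚ; mkℚ; 0ℚ; 1ℚ; ½)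
import Data.Rational.Properties as ℚ
open import Data.Rational.Solver using (module +-*-Solver)
open import Data.Rational.Unnormalised.Base as ℚᵘ using (mkℚᵘ; *≡*; *≤*)
import Data.Rational.Unnormalised.Properties as ℚᵘ
open import Function.Base using (_∘_)
open import Relation.Binary.Core using (Rel)
open import Relation.Binary.PropositionalEquality as ≡ using (_≡_)
open import Relation.Binary.Structures using (IsEquivalence)
open import Algebra.Properties.CommutativeSemiring.Exp (CommutativeRing.commutativeSemiring ℚ.+-*-commutativeRing)
  using () renaming (_^_ to _^ℚ_; ^-distrib-* to ^ℚ-distrib-*)
import Algebra.Properties.Semiring.Sum (CommutativeRing.semiring ℚ.+-*-commutativeRing) as ℚSum
open import Defs using (stirling₂; Null; null-*; null-resp; bounded; fromℚ)

-- Read sequences as exponential generating functions in u, and let b(u) belong to the sequence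
-- Bₖ(x). Multiplying u e^(xu) = b(u) (e^u - 1) by (e^u - 1)^m / m! gives n {n-1, m}ₓ on the left
-- and (m + 1) times b convolved with column m + 1 of the Stirling numbers on the right, so x
-- disappears from the sum. The missing term m = 0 is Bₙ(x) itself, which explains why it stands
-- alone in the formulas. Bₙ(x + t) is entry n of the convolution of b with the powers of t, so
-- integrating over t only replaces tᵏ by its moment. As -t runs over [-1, 0], the second kind leads
-- to y = -1 and to the power (x - 1)ⁿ. The hypotheses supply integrals of the binomials only. On
-- uniform partitions with rational tags the Riemann sums are exact rationals; there linearity is
-- that of finite sums, and the k-th moment can be the plain number 1/(k+1), up to sign, without any
-- theory of integration.

stirling₂-vanishes : ∀ {n m} → n ℕ.< m → stirling₂ n m ≡ 0
stirling₂-vanishes {zero}  {suc m} _ = ≡.refl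
stirling₂-vanishes {suc n} {suc m} (ℕ.s≤s n<m)
  rewrite stirling₂-vanishes (ℕ.m≤n⇒m≤1+n n<m) | stirling₂-vanishes n<m | ℕ.*-zeroʳ m = ≡.refl

-- Binomial convolutions over a commutative ring

module Convolution
  {c ℓ} (R : CommutativeRing c ℓ)
  (nat : ℕ → CommutativeRing.Carrier R)
  (nat-zero : CommutativeRing._≈_ R (nat 0) (CommutativeRing.0# R))
  (nat-suc : ∀ n → CommutativeRing._≈_ R (nat (suc n)) (CommutativeRing._+_ R (CommutativeRing.1# R) (nat n)))
  where

  open CommutativeRing R
  open import Algebra.Properties.Ring ring using (+-cancelʳ)
  open import Algebra.Properties.Semiring.Exp semiring using (_^_; ^-congˡ)
  open import Algebra.Properties.Semiring.Sum semiring
  open import Algebra.Solver.Ring.NaturalCoefficients.Default commutativeSemiring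
    using (solve; _:+_; _:*_; _:=_)
  open import Relation.Binary.Reasoning.Setoid setoid

  Sequence : Set c
  Sequence = ℕ → Carrier

  infix 4 _≐_
  _≐_ : Sequence → Sequence → Set ℓ
  a ≐ b = ∀ n → a n ≈ b n

  +-interchange : ∀ p q r s → (p + q) + (r + s) ≈ (p + r) + (q + s)
  +-interchange = solve 4 (λ p q r s → (p :+ q) :+ (r :+ s) := (p :+ r) :+ (q :+ s)) refl

  Σ< : ℕ → Sequence → Carrier
  Σ< n f = ∑[ i < n ] f (toℕ i)

  Σ<-cong : ∀ n {f g} → (∀ i → i ℕ.< n → f i ≈ g i) → Σ< n f ≈ Σ< n g
  Σ<-cong n f≈g = sum-cong-≋ (λ i → f≈g (toℕ i) (toℕ<n i))

  Σ<-last : ∀ n f → Σ< (suc n) f ≈ Σ< n f + f n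
  Σ<-last zero    f = +-comm (f 0) 0#
  Σ<-last (suc n) f = trans (+-congˡ (Σ<-last n (f ∘ suc))) (sym (+-assoc _ _ _))

  Σ<-+ : ∀ n f g → Σ< n (λ i → f i + g i) ≈ Σ< n f + Σ< n g
  Σ<-+ n f g = ∑-distrib-+ {n} (f ∘ toℕ) (g ∘ toℕ)

  Σ<-zero : ∀ n {f} → (∀ i → f i ≈ 0#) → Σ< n f ≈ 0#
  Σ<-zero n f≈0 = trans (Σ<-cong n λ i _ → f≈0 i) (sum-replicate-zero n)

  *-distribˡ-Σ< : ∀ n x f → x * Σ< n f ≈ Σ< n (λ i → x * f i)
  *-distribˡ-Σ< n x f = *-distribˡ-sum {n} x (f ∘ toℕ)

  Σ<-comm : ∀ m n (f : ℕ → ℕ → Carrier) →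
            Σ< m (λ i → Σ< n (λ j → f i j)) ≈ Σ< n (λ j → Σ< m (λ i → f i j))
  Σ<-comm m n f = ∑-comm {m} {n} (λ i j → f (toℕ i) (toℕ j))

  *-distribʳ-Σ< : ∀ n x f → Σ< n f * x ≈ Σ< n (λ i → f i * x)
  *-distribʳ-Σ< n x f = *-distribʳ-sum {n} x (f ∘ toℕ)

  Σ<-truncate : ∀ {m n f} → m ℕ.≤ n → (∀ i → m ℕ.≤ i → i ℕ.< n → f i ≈ 0#) → Σ< n f ≈ Σ< m f
  Σ<-truncate {zero}  {n} _ f≈0 = trans (Σ<-cong n (λ i → f≈0 i ℕ.z≤n)) (Σ<-zero n (λ _ → refl))
  Σ<-truncate {suc m} {suc n} (ℕ.s≤s m≤n) f≈0 =
    +-congˡ (Σ<-truncate m≤n λ i m≤i i<n → f≈0 (suc i) (ℕ.s≤s m≤i) (ℕ.s≤s i<n))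

  nat-one : nat 1 ≈ 1#
  nat-one = trans (nat-suc 0) (trans (+-congˡ nat-zero) (+-identityʳ 1#))

  nat-+ : ∀ m n → nat (m ℕ.+ n) ≈ nat m + nat n
  nat-+ zero    n = sym (trans (+-congʳ nat-zero) (+-identityˡ (nat n)))
  nat-+ (suc m) n = begin
    nat (suc (m ℕ.+ n))    ≈⟨ nat-suc (m ℕ.+ n) ⟩
    1# + nat (m ℕ.+ n)     ≈⟨ +-congˡ (nat-+ m n) ⟩
    1# + (nat m + nat n)   ≈⟨ +-assoc 1# (nat m) (nat n) ⟨
    (1# + nat m) + nat n   ≈⟨ +-congʳ (nat-suc m) ⟨
    nat (suc m) + nat n    ∎

  nat-* : ∀ m n → nat (m ℕ.* n) ≈ nat m * nat n
  nat-* zero    n = trans nat-zero (sym (trans (*-congʳ nat-zero) (zeroˡ (nat n))))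
  nat-* (suc m) n = begin
    nat (n ℕ.+ m ℕ.* n)            ≈⟨ nat-+ n (m ℕ.* n) ⟩
    nat n + nat (m ℕ.* n)          ≈⟨ +-cong (sym (*-identityˡ (nat n))) (nat-* m n) ⟩
    1# * nat n + nat m * nat n     ≈⟨ distribʳ (nat n) 1# (nat m) ⟨
    (1# + nat m) * nat n           ≈⟨ *-congʳ (nat-suc m) ⟨
    nat (suc m) * nat n            ∎

  nat-^ : ∀ m n → nat (m ℕ.^ n) ≈ nat m ^ n
  nat-^ m zero    = nat-one
  nat-^ m (suc n) = trans (nat-* m (m ℕ.^ n)) (*-congˡ (nat-^ m n))

  nat-≡ : ∀ {m n} → m ≡ n → nat m ≈ nat n
  nat-≡ = reflexive ∘ ≡.cong nat

  -- The binomial convolution ∑ᵢ (n C i) aᵢ bₙ₋ᵢ, i.e. the product of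
  -- exponential generating functions.  The recursion is the Leibniz rule:
  -- differentiation of such a series shifts its sequence.
  infixl 7 _⋆_
  _⋆_ : Sequence → Sequence → Sequence
  (a ⋆ b) zero    = a 0 * b 0
  (a ⋆ b) (suc n) = ((a ∘ suc) ⋆ b) n + (a ⋆ (b ∘ suc)) n

  -- Entry n sees only the entries up to n of both factors. The bounded form is needed in
  -- `bernoulli-stirling`, where a sum of fixed length equals `μ k` only for small k.
  ⋆-cong-≤ : ∀ n {a a′ b b′} → (∀ k → k ℕ.≤ n → a k ≈ a′ k) → (∀ k → k ℕ.≤ n → b k ≈ b′ k) →
             (a ⋆ b) n ≈ (a′ ⋆ b′) n
  ⋆-cong-≤ zero    p q = *-cong (p 0 ℕ.z≤n) (q 0 ℕ.z≤n)
  ⋆-cong-≤ (suc n) p q = +-cong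
    (⋆-cong-≤ n (λ k k≤n → p (suc k) (ℕ.s≤s k≤n)) (λ k k≤n → q k (ℕ.m≤n⇒m≤1+n k≤n)))
    (⋆-cong-≤ n (λ k k≤n → p k (ℕ.m≤n⇒m≤1+n k≤n)) (λ k k≤n → q (suc k) (ℕ.s≤s k≤n)))

  ⋆-congˡ : ∀ {a b b′} → b ≐ b′ → a ⋆ b ≐ a ⋆ b′
  ⋆-congˡ q n = ⋆-cong-≤ n (λ _ _ → refl) (λ k _ → q k)

  ⋆-congʳ : ∀ {a a′ b} → a ≐ a′ → a ⋆ b ≐ a′ ⋆ b
  ⋆-congʳ p n = ⋆-cong-≤ n (λ k _ → p k) (λ _ _ → refl)

  ⋆-comm : ∀ a b → a ⋆ b ≐ b ⋆ a
  ⋆-comm a b zero    = *-comm (a 0) (b 0)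
  ⋆-comm a b (suc n) =
    trans (+-cong (⋆-comm (a ∘ suc) b n) (⋆-comm a (b ∘ suc) n)) (+-comm _ _)

  ⋆-distribˡ : ∀ a b d n → (a ⋆ (λ k → b k + d k)) n ≈ (a ⋆ b) n + (a ⋆ d) n
  ⋆-distribˡ a b d zero    = distribˡ (a 0) (b 0) (d 0)
  ⋆-distribˡ a b d (suc n) = trans
    (+-cong (⋆-distribˡ (a ∘ suc) b d n) (⋆-distribˡ a (b ∘ suc) (d ∘ suc) n))
    (+-interchange _ _ _ _)

  ⋆-distribʳ : ∀ a b d n → ((λ k → b k + d k) ⋆ a) n ≈ (b ⋆ a) n + (d ⋆ a) n
  ⋆-distribʳ a b d n = trans (⋆-comm _ a n)
    (trans (⋆-distribˡ a b d n) (+-cong (⋆-comm a b n) (⋆-comm a d n)))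

  -- Both sides satisfy the Leibniz rule for three factors. Induction on the entry, for all
  -- sequences at once, therefore avoids any manipulation of binomial coefficients.
  ⋆-assoc : ∀ a b d → (a ⋆ b) ⋆ d ≐ a ⋆ (b ⋆ d)
  ⋆-assoc a b d zero    = *-assoc (a 0) (b 0) (d 0)
  ⋆-assoc a b d (suc n) = begin
    ((λ k → (a′ ⋆ b) k + (a ⋆ b′) k) ⋆ d) n + ((a ⋆ b) ⋆ d′) n
      ≈⟨ +-cong (⋆-distribʳ d (a′ ⋆ b) (a ⋆ b′) n) (⋆-assoc a b d′ n) ⟩
    (((a′ ⋆ b) ⋆ d) n + ((a ⋆ b′) ⋆ d) n) + (a ⋆ (b ⋆ d′)) n
      ≈⟨ +-congʳ (+-cong (⋆-assoc a′ b d n) (⋆-assoc a b′ d n)) ⟩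
    ((a′ ⋆ (b ⋆ d)) n + (a ⋆ (b′ ⋆ d)) n) + (a ⋆ (b ⋆ d′)) n
      ≈⟨ +-assoc _ _ _ ⟩
    (a′ ⋆ (b ⋆ d)) n + ((a ⋆ (b′ ⋆ d)) n + (a ⋆ (b ⋆ d′)) n)
      ≈⟨ +-congˡ (⋆-distribˡ a (b′ ⋆ d) (b ⋆ d′) n) ⟨
    (a′ ⋆ (b ⋆ d)) n + (a ⋆ (λ k → (b′ ⋆ d) k + (b ⋆ d′) k)) n
      ∎
    where
    a′ = a ∘ suc
    b′ = b ∘ suc
    d′ = d ∘ suc

  ⋆-swap : ∀ a b d → a ⋆ (b ⋆ d) ≐ b ⋆ (a ⋆ d)
  ⋆-swap a b d n = begin
    (a ⋆ (b ⋆ d)) n  ≈⟨ ⋆-assoc a b d n ⟨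
    ((a ⋆ b) ⋆ d) n  ≈⟨ ⋆-congʳ (⋆-comm a b) n ⟩
    ((b ⋆ a) ⋆ d) n  ≈⟨ ⋆-assoc b a d n ⟩
    (b ⋆ (a ⋆ d)) n  ∎

  ⋆-*ˡ : ∀ x a b n → (a ⋆ (λ k → x * b k)) n ≈ x * (a ⋆ b) n
  ⋆-*ˡ x a b zero    = solve 3 (λ x a b → a :* (x :* b) := x :* (a :* b)) refl x (a 0) (b 0)
  ⋆-*ˡ x a b (suc n) =
    trans (+-cong (⋆-*ˡ x (a ∘ suc) b n) (⋆-*ˡ x a (b ∘ suc) n)) (sym (distribˡ x _ _))

  ⋆-zeroˡ : ∀ b n → ((λ _ → 0#) ⋆ b) n ≈ 0#
  ⋆-zeroˡ b zero    = zeroˡ (b 0)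
  ⋆-zeroˡ b (suc n) = trans (+-cong (⋆-zeroˡ b n) (⋆-zeroˡ (b ∘ suc) n)) (+-identityˡ 0#)

  ⋆-Σ< : ∀ a m (f : ℕ → Sequence) n →
         (a ⋆ (λ k → Σ< m (λ i → f i k))) n ≈ Σ< m (λ i → (a ⋆ f i) n)
  ⋆-Σ< a zero    f n = trans (⋆-comm a _ n) (⋆-zeroˡ a n)
  ⋆-Σ< a (suc m) f n = trans (⋆-distribˡ a (f 0) _ n) (+-congˡ (⋆-Σ< a m (f ∘ suc) n))

  -- Pascal's rule is the Leibniz recursion seen on coefficients. The second sum loses its top term
  -- because n C (n + 1) = 0, and `g` depends on both indices so that one lemma covers the shift of
  -- either factor.
  Σ<-pascal : ∀ n (g : ℕ → ℕ → Carrier) →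
    Σ< (suc (suc n)) (λ i → nat (suc n C i) * g i (suc n ∸ i)) ≈
    Σ< (suc n) (λ i → nat (n C i) * g (suc i) (n ∸ i)) +
    Σ< (suc n) (λ i → nat (n C i) * g i (suc (n ∸ i)))
  Σ<-pascal n g = begin
    nat 1 * g 0 (suc n) + Σ< (suc n) (λ i → nat (suc n C suc i) * g (suc i) (n ∸ i))
      ≈⟨ +-congˡ (Σ<-cong (suc n) λ i _ → pascal i) ⟩
    nat 1 * g 0 (suc n) + Σ< (suc n) (λ i → p i + q (suc i))
      ≈⟨ +-congˡ (Σ<-+ (suc n) p (q ∘ suc)) ⟩
    nat 1 * g 0 (suc n) + (Σ< (suc n) p + Σ< (suc n) (q ∘ suc))
      ≈⟨ solve 3 (λ x y z → x :+ (y :+ z) := y :+ (x :+ z)) refl _ _ _ ⟩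
    Σ< (suc n) p + Σ< (suc (suc n)) q
      ≈⟨ +-congˡ (Σ<-last (suc n) q) ⟩
    Σ< (suc n) p + (Σ< (suc n) q + q (suc n))
      ≈⟨ +-congˡ (+-congˡ q-last) ⟩
    Σ< (suc n) p + (Σ< (suc n) q + 0#)
      ≈⟨ +-congˡ (+-identityʳ _) ⟩
    Σ< (suc n) p + Σ< (suc n) q
      ≈⟨ +-congˡ (Σ<-cong (suc n) λ i i<1+n →
           *-congˡ {nat (n C i)} (reflexive (≡.cong (g i) (ℕ.+-∸-assoc 1 (ℕ.s≤s⁻¹ i<1+n))))) ⟩
    Σ< (suc n) p + Σ< (suc n) (λ i → nat (n C i) * g i (suc (n ∸ i)))
      ∎
    where
    p q : Sequence
    p i = nat (n C i) * g (suc i) (n ∸ i)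
    q i = nat (n C i) * g i (suc n ∸ i)
    pascal : ∀ i → nat (suc n C suc i) * g (suc i) (n ∸ i) ≈ p i + q (suc i)
    pascal i = trans
      (*-congʳ (trans (nat-≡ (≡.sym (nCk+nC[k+1]≡[n+1]C[k+1] n i))) (nat-+ (n C i) (n C suc i))))
      (distribʳ _ _ _)
    q-last : q (suc n) ≈ 0#
    q-last = trans (*-congʳ (trans (nat-≡ (k>n⇒nCk≡0 (ℕ.n<1+n n))) nat-zero)) (zeroˡ _)

  ⋆-binomial : ∀ n a b → (a ⋆ b) n ≈ Σ< (suc n) (λ i → nat (n C i) * (a i * b (n ∸ i)))
  ⋆-binomial zero    a b =
    sym (trans (+-identityʳ _) (trans (*-congʳ nat-one) (*-identityˡ (a 0 * b 0))))
  ⋆-binomial (suc n) a b = trans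
    (+-cong (⋆-binomial n (a ∘ suc) b) (⋆-binomial n a (b ∘ suc)))
    (sym (Σ<-pascal n (λ i j → a i * b j)))

  -- Powers, Stirling numbers and falling factorials as sequences

  δ : Sequence
  δ zero    = 1#
  δ (suc _) = 0#

  -- The sequences with exponential generating functions exp t - 1 and t.
  expm1 : Sequence
  expm1 zero    = 0#
  expm1 (suc _) = 1#

  X : Sequence
  X zero    = 0#
  X (suc n) = δ n

  -- Column m of the Stirling triangle; its exponential generating function is (exp t - 1)^m / m!.
  S : ℕ → Sequence
  S m n = nat (stirling₂ n m)

  ⋆-identityˡ : ∀ a → δ ⋆ a ≐ a
  ⋆-identityˡ a zero    = *-identityˡ (a 0)
  ⋆-identityˡ a (suc n) = trans
    (+-cong (⋆-zeroˡ a n) (⋆-identityˡ (a ∘ suc) n)) (+-identityˡ (a (suc n)))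

  X⋆-suc : ∀ a n → (X ⋆ a) (suc n) ≈ nat (suc n) * a n
  X⋆-suc a zero = begin
    1# * a 0 + 0# * a 1  ≈⟨ +-cong (*-congʳ (sym nat-one)) (zeroˡ (a 1)) ⟩
    nat 1 * a 0 + 0#     ≈⟨ +-identityʳ _ ⟩
    nat 1 * a 0          ∎
  X⋆-suc a (suc n) = begin
    (δ ⋆ a) (suc n) + (X ⋆ (a ∘ suc)) (suc n)    ≈⟨ +-cong (⋆-identityˡ a (suc n)) (X⋆-suc (a ∘ suc) n) ⟩
    a (suc n) + nat (suc n) * a (suc n)          ≈⟨ +-congʳ (*-identityˡ (a (suc n))) ⟨
    1# * a (suc n) + nat (suc n) * a (suc n)     ≈⟨ distribʳ (a (suc n)) 1# (nat (suc n)) ⟨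
    (1# + nat (suc n)) * a (suc n)               ≈⟨ *-congʳ (nat-suc (suc n)) ⟨
    nat (suc (suc n)) * a (suc n)                ∎

  ^-⋆ : ∀ x y → (x ^_) ⋆ (y ^_) ≐ (x + y) ^_
  ^-⋆ x y zero    = *-identityˡ 1#
  ^-⋆ x y (suc n) = begin
    ((λ k → x * x ^ k) ⋆ (y ^_)) n + ((x ^_) ⋆ (λ k → y * y ^ k)) n
      ≈⟨ +-cong (trans (⋆-comm _ (y ^_) n) (trans (⋆-*ˡ x (y ^_) (x ^_) n) (*-congˡ (⋆-comm (y ^_) (x ^_) n)))) (⋆-*ˡ y (x ^_) (y ^_) n) ⟩
    x * ((x ^_) ⋆ (y ^_)) n + y * ((x ^_) ⋆ (y ^_)) n
      ≈⟨ distribʳ _ x y ⟨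
    (x + y) * ((x ^_) ⋆ (y ^_)) n
      ≈⟨ *-congˡ (^-⋆ x y n) ⟩
    (x + y) * (x + y) ^ n
      ∎

  ones : Sequence
  ones _ = 1#

  ones≐ : ones ≐ 1# ^_
  ones≐ zero    = refl
  ones≐ (suc n) = trans (ones≐ n) (sym (*-identityˡ (1# ^ n)))

  expm1+δ : ∀ n → expm1 n + δ n ≈ ones n
  expm1+δ zero    = +-identityˡ 1#
  expm1+δ (suc n) = +-identityʳ 1#

  expm1-⋆ : ∀ a n → (expm1 ⋆ a) n + a n ≈ (ones ⋆ a) n
  expm1-⋆ a n = begin
    (expm1 ⋆ a) n + a n                ≈⟨ +-congˡ (⋆-identityˡ a n) ⟨
    (expm1 ⋆ a) n + (δ ⋆ a) n          ≈⟨ ⋆-distribʳ a expm1 δ n ⟨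
    ((λ k → expm1 k + δ k) ⋆ a) n      ≈⟨ ⋆-congʳ expm1+δ n ⟩
    (ones ⋆ a) n                       ∎

  S-suc : ∀ n m → S (suc m) (suc n) ≈ nat (suc m) * S (suc m) n + S m n
  S-suc n m = trans (nat-+ (suc m ℕ.* stirling₂ n (suc m)) (stirling₂ n m))
                    (+-congʳ (nat-* (suc m) (stirling₂ n (suc m))))

  -- The derivative of (exp t - 1)^(m+1) / (m+1)! is exp t (exp t - 1)^m / m!. In terms of
  -- partitions: choose the elements that share a block with one additional point.
  ones⋆S : ∀ m n → (ones ⋆ S m) n ≈ S (suc m) (suc n)
  ones⋆S m zero = trans (*-identityˡ (S m 0)) (nat-≡ (≡.sym (≡.cong (ℕ._+ stirling₂ 0 m) (ℕ.*-zeroʳ (suc m)))))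
  ones⋆S zero (suc n) = begin
    (ones ⋆ S 0) n + (ones ⋆ (λ _ → nat 0)) n  ≈⟨ +-cong (ones⋆S 0 n) (⋆-comm ones _ n) ⟩
    S 1 (suc n) + ((λ _ → nat 0) ⋆ ones) n     ≈⟨ +-congˡ (⋆-congʳ (λ _ → nat-zero) n) ⟩
    S 1 (suc n) + ((λ _ → 0#) ⋆ ones) n        ≈⟨ +-congˡ (⋆-zeroˡ ones n) ⟩
    S 1 (suc n) + 0#                           ≈⟨ +-identityʳ _ ⟩
    S 1 (suc n)                                ≈⟨ nat-≡ (≡.sym (≡.trans (ℕ.+-identityʳ _) (ℕ.+-identityʳ _))) ⟩
    S 1 (suc (suc n))                          ∎
  ones⋆S (suc m) (suc n) = begin
    (ones ⋆ S (suc m)) n + (ones ⋆ (S (suc m) ∘ suc)) n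
      ≈⟨ +-cong (ones⋆S (suc m) n) (⋆-congˡ (λ k → S-suc k m) n) ⟩
    s + (ones ⋆ (λ k → nat (suc m) * S (suc m) k + S m k)) n
      ≈⟨ +-congˡ (⋆-distribˡ ones _ (S m) n) ⟩
    s + ((ones ⋆ (λ k → nat (suc m) * S (suc m) k)) n + (ones ⋆ S m) n)
      ≈⟨ +-congˡ (+-cong (⋆-*ˡ (nat (suc m)) ones (S (suc m)) n) (ones⋆S m n)) ⟩
    s + (nat (suc m) * (ones ⋆ S (suc m)) n + S (suc m) (suc n))
      ≈⟨ +-cong (sym (*-identityˡ s)) (+-congʳ (*-congˡ (ones⋆S (suc m) n))) ⟩
    1# * s + (nat (suc m) * s + S (suc m) (suc n))
      ≈⟨ solve 4 (λ i k s t → i :* s :+ (k :* s :+ t) := (i :+ k) :* s :+ t) refl _ _ _ _ ⟩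
    (1# + nat (suc m)) * s + S (suc m) (suc n)
      ≈⟨ +-congʳ (*-congʳ (nat-suc (suc m))) ⟨
    nat (suc (suc m)) * s + S (suc m) (suc n)
      ≈⟨ S-suc (suc n) (suc m) ⟨
    S (suc (suc m)) (suc (suc n))
      ∎
    where s = S (suc (suc m)) (suc n)

  -- One more factor exp t - 1 raises the column: this is (exp t - 1)^(m+1) / m!, written without
  -- division. Adding `S m n` to both sides trades `expm1` for `ones`.
  expm1⋆S : ∀ m n → (expm1 ⋆ S m) n ≈ nat (suc m) * S (suc m) n
  expm1⋆S m n = +-cancelʳ (S m n) _ _ (begin
    (expm1 ⋆ S m) n + S m n              ≈⟨ expm1-⋆ (S m) n ⟩
    (ones ⋆ S m) n                       ≈⟨ ones⋆S m n ⟩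
    S (suc m) (suc n)                    ≈⟨ S-suc n m ⟩
    nat (suc m) * S (suc m) n + S m n    ∎)

  S0≐δ : S 0 ≐ δ
  S0≐δ zero    = nat-one
  S0≐δ (suc n) = nat-zero

  falling : Carrier → Sequence
  falling z zero    = 1#
  falling z (suc n) = falling z n * (z - nat n)

  -- Induction on k by z (z)ₘ = (z)ₘ₊₁ + m (z)ₘ, matched with the Stirling recurrence. The length M
  -- is any bound above k, so that a single M serves all the powers occurring in one convolution.
  ^-as-falling : ∀ z k M → k ℕ.< M → Σ< M (λ m → falling z m * S m k) ≈ z ^ k
  ^-as-falling z zero (suc M) _ = begin
    1# * nat 1 + Σ< M (λ m → falling z (suc m) * nat 0)
      ≈⟨ +-cong (trans (*-identityˡ _) nat-one) (Σ<-zero M λ m → trans (*-congˡ {falling z (suc m)} nat-zero) (zeroʳ (falling z (suc m)))) ⟩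
    1# + 0#
      ≈⟨ +-identityʳ 1# ⟩
    1#
      ∎
  ^-as-falling z (suc k) (suc M) (ℕ.s≤s k<M) = begin
    1# * nat 0 + Σ< M (λ m → f (suc m) * S (suc m) (suc k))
      ≈⟨ +-congʳ (trans (*-congˡ nat-zero) (zeroʳ 1#)) ⟩
    0# + Σ< M (λ m → f (suc m) * S (suc m) (suc k))
      ≈⟨ +-identityˡ _ ⟩
    Σ< M (λ m → f (suc m) * S (suc m) (suc k))
      ≈⟨ Σ<-cong M (λ m _ → split m) ⟩
    Σ< M (λ m → h (suc m) + g m)
      ≈⟨ Σ<-+ M (h ∘ suc) g ⟩
    Σ< M (h ∘ suc) + Σ< M g
      ≈⟨ +-congʳ shift ⟩
    Σ< M h + Σ< M g
      ≈⟨ Σ<-+ M h g ⟨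
    Σ< M (λ m → h m + g m)
      ≈⟨ Σ<-cong M (λ m _ → merge m) ⟩
    Σ< M (λ m → z * (f m * S m k))
      ≈⟨ *-distribˡ-Σ< M z (λ m → f m * S m k) ⟨
    z * Σ< M (λ m → f m * S m k)
      ≈⟨ *-congˡ (^-as-falling z k M k<M) ⟩
    z * z ^ k
      ∎
    where
    f h g : Sequence
    f = falling z
    h m = nat m * (f m * S m k)
    g m = (f m * S m k) * (z - nat m)
    split : ∀ m → f (suc m) * S (suc m) (suc k) ≈ h (suc m) + g m
    split m = trans (*-congˡ (S-suc k m))
      (solve 5 (λ a b c d e → (a :* b) :* (c :* d :+ e) := c :* ((a :* b) :* d) :+ (a :* e) :* b) refl
        (f m) (z - nat m) (nat (suc m)) (S (suc m) k) (S m k))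
    merge : ∀ m → h m + g m ≈ z * (f m * S m k)
    merge m = begin
      nat m * p + p * (z - nat m)     ≈⟨ solve 4 (λ n p z w → n :* p :+ p :* (z :+ w) := p :* z :+ (n :+ w) :* p) refl _ _ _ _ ⟩
      p * z + (nat m - nat m) * p     ≈⟨ +-cong (*-comm p z) (trans (*-congʳ (-‿inverseʳ (nat m))) (zeroˡ p)) ⟩
      z * p + 0#                      ≈⟨ +-identityʳ _ ⟩
      z * p                           ∎
      where p = f m * S m k
    -- Both boundary terms vanish: `h 0` has the factor 0, and `h M` contains `S M k` with k < M.
    shift : Σ< M (h ∘ suc) ≈ Σ< M h
    shift = begin
      Σ< M (h ∘ suc)          ≈⟨ +-identityˡ _ ⟨
      0# + Σ< M (h ∘ suc)     ≈⟨ +-congʳ (trans (*-congʳ nat-zero) (zeroˡ _)) ⟨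
      Σ< (suc M) h            ≈⟨ Σ<-last M h ⟩
      Σ< M h + h M            ≈⟨ +-congˡ (trans (*-congˡ (trans (*-congˡ (trans (nat-≡ (stirling₂-vanishes k<M)) nat-zero)) (zeroʳ _))) (zeroʳ _)) ⟩
      Σ< M h + 0#             ≈⟨ +-identityʳ _ ⟩
      Σ< M h                  ∎

  -- The convolution is the generalized Stirling number with parameter x. Its binomial sum runs up
  -- to i = n, but for i > n - m fewer than m elements are left to form m blocks.
  ^-⋆-S : ∀ x {m n} → m ℕ.≤ n →
    ((x ^_) ⋆ S m) n ≈ Σ< (suc (n ∸ m)) (λ i → nat ((n C i) ℕ.* stirling₂ (n ∸ i) m) * x ^ i)
  ^-⋆-S x {m} {n} m≤n = begin
    ((x ^_) ⋆ S m) n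
      ≈⟨ ⋆-binomial n (x ^_) (S m) ⟩
    Σ< (suc n) (λ i → nat (n C i) * (x ^ i * S m (n ∸ i)))
      ≈⟨ Σ<-cong (suc n) (λ i _ → regroup i) ⟩
    Σ< (suc n) term
      ≈⟨ Σ<-truncate (ℕ.s≤s (ℕ.m∸n≤m n m)) vanish ⟩
    Σ< (suc (n ∸ m)) term
      ∎
    where
    term : Sequence
    term i = nat ((n C i) ℕ.* stirling₂ (n ∸ i) m) * x ^ i
    regroup : ∀ i → nat (n C i) * (x ^ i * S m (n ∸ i)) ≈ term i
    regroup i = trans
      (solve 3 (λ a b c → a :* (b :* c) := (a :* c) :* b) refl (nat (n C i)) (x ^ i) (S m (n ∸ i)))
      (*-congʳ (sym (nat-* (n C i) (stirling₂ (n ∸ i) m))))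
    vanish : ∀ i → suc (n ∸ m) ℕ.≤ i → i ℕ.< suc n → term i ≈ 0#
    vanish i i> (ℕ.s≤s i≤n) = trans
      (*-congʳ (trans (nat-≡ (≡.trans (≡.cong ((n C i) ℕ.*_) (stirling₂-vanishes n∸i<m)) (ℕ.*-zeroʳ (n C i)))) nat-zero))
      (zeroˡ (x ^ i))
      where
      n∸i<m : n ∸ i ℕ.< m
      n∸i<m = ℕ.≰⇒> λ m≤n∸i → ℕ.<⇒≱ i> (ℕ.m+n≤o⇒m≤o∸n i
        (≡.subst (ℕ._≤ n) (ℕ.+-comm m i) (ℕ.m≤o∸n⇒m+n≤o m i≤n m≤n∸i)))

  -- Division by factorials and ordinary generating series

  module Reciprocals
    (recip : ∀ n .{{_ : NonZero n}} → Carrier)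
    (recip-inverse : ∀ n .{{_ : NonZero n}} → nat n * recip n ≈ 1#)
    where

    nat-*-cancel : ∀ n .{{_ : NonZero n}} {x y} → nat n * x ≈ nat n * y → x ≈ y
    nat-*-cancel n {x} {y} eq = trans (sym (undo x)) (trans (*-congˡ eq) (undo y))
      where
      undo : ∀ z → recip n * (nat n * z) ≈ z
      undo z = begin
        recip n * (nat n * z)   ≈⟨ *-assoc (recip n) (nat n) z ⟨
        (recip n * nat n) * z   ≈⟨ *-congʳ (trans (*-comm (recip n) (nat n)) (recip-inverse n)) ⟩
        1# * z                  ≈⟨ *-identityˡ z ⟩
        z                       ∎

    egf : Sequence → Sequence
    egf a n = a n * recip (n !) {{n ℕ.!≢0}}

    binomial-recip : ∀ {n i} → i ℕ.≤ n →
      recip (i !) {{i ℕ.!≢0}} * recip ((n ∸ i) !) {{(n ∸ i) ℕ.!≢0}} ≈ nat (n C i) * recip (n !) {{n ℕ.!≢0}}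
    binomial-recip {n} {i} i≤n = begin
      p * q                             ≈⟨ *-identityʳ (p * q) ⟨
      (p * q) * 1#                      ≈⟨ *-congˡ (recip-inverse (n !)) ⟨
      (p * q) * (nat (n !) * r)         ≈⟨ *-congˡ (*-congʳ factorials) ⟩
      (p * q) * ((b * (u * v)) * r)     ≈⟨ solve 6 (λ p q b u v r → (p :* q) :* ((b :* (u :* v)) :* r) := ((u :* p) :* (v :* q)) :* (b :* r)) refl p q b u v r ⟩
      ((u * p) * (v * q)) * (b * r)     ≈⟨ *-congʳ (*-cong (recip-inverse (i !)) (recip-inverse ((n ∸ i) !))) ⟩
      (1# * 1#) * (b * r)               ≈⟨ trans (*-congʳ (*-identityˡ 1#)) (*-identityˡ (b * r)) ⟩
      b * r                             ∎
      where
      instance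
        n!≢0 = n ℕ.!≢0
        i!≢0 = i ℕ.!≢0
        n∸i!≢0 = (n ∸ i) ℕ.!≢0
        i!*n∸i!≢0 = i ℕ.!* (n ∸ i) !≢0
      p = recip (i !)
      q = recip ((n ∸ i) !)
      r = recip (n !)
      b = nat (n C i)
      u = nat (i !)
      v = nat ((n ∸ i) !)
      factorials : nat (n !) ≈ b * (u * v)
      factorials = begin
        nat (n !)                                     ≈⟨ nat-≡ (≡.trans (≡.cong (ℕ._* (i ! ℕ.* (n ∸ i) !)) (nCk≡n!/k![n-k]! i≤n)) (m/n*n≡m (k![n∸k]!∣n! i≤n))) ⟨
        nat ((n C i) ℕ.* (i ! ℕ.* (n ∸ i) !))         ≈⟨ nat-* (n C i) (i ! ℕ.* (n ∸ i) !) ⟩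
        b * nat (i ! ℕ.* (n ∸ i) !)                   ≈⟨ *-congˡ (nat-* (i !) ((n ∸ i) !)) ⟩
        b * (u * v)                                   ∎

    -- Translates the Cauchy product, in which the Bernoulli polynomials are defined, into the
    -- convolution.
    egf-⋆ : ∀ a b n → Σ< (suc n) (λ i → egf a i * egf b (n ∸ i)) ≈ egf (a ⋆ b) n
    egf-⋆ a b n = begin
      Σ< (suc n) (λ i → egf a i * egf b (n ∸ i))
        ≈⟨ Σ<-cong (suc n) (λ i i<1+n → term i (ℕ.s≤s⁻¹ i<1+n)) ⟩
      Σ< (suc n) (λ i → (nat (n C i) * (a i * b (n ∸ i))) * r)
        ≈⟨ *-distribʳ-Σ< (suc n) r (λ i → nat (n C i) * (a i * b (n ∸ i))) ⟨
      Σ< (suc n) (λ i → nat (n C i) * (a i * b (n ∸ i))) * r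
        ≈⟨ *-congʳ (⋆-binomial n a b) ⟨
      (a ⋆ b) n * r
        ∎
      where
      r = recip (n !) {{n ℕ.!≢0}}
      term : ∀ i → i ℕ.≤ n → egf a i * egf b (n ∸ i) ≈ (nat (n C i) * (a i * b (n ∸ i))) * r
      term i i≤n = begin
        (a i * recip (i !) {{i ℕ.!≢0}}) * (b (n ∸ i) * recip ((n ∸ i) !) {{(n ∸ i) ℕ.!≢0}})
          ≈⟨ solve 4 (λ a p b q → (a :* p) :* (b :* q) := (a :* b) :* (p :* q)) refl _ _ _ _ ⟩
        (a i * b (n ∸ i)) * (recip (i !) {{i ℕ.!≢0}} * recip ((n ∸ i) !) {{(n ∸ i) ℕ.!≢0}})
          ≈⟨ *-congˡ (binomial-recip i≤n) ⟩
        (a i * b (n ∸ i)) * (nat (n C i) * r)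
          ≈⟨ solve 3 (λ p c r → p :* (c :* r) := (c :* p) :* r) refl _ _ _ ⟩
        (nat (n C i) * (a i * b (n ∸ i))) * r
          ∎

    egf-injective : ∀ a b n → egf a n ≈ egf b n → a n ≈ b n
    egf-injective a b n eq = trans (sym (undo (a n))) (trans (*-congˡ eq) (undo (b n)))
      where
      instance n!≢0 = n ℕ.!≢0
      undo : ∀ z → nat (n !) * (z * recip (n !)) ≈ z
      undo z = trans (solve 3 (λ m z r → m :* (z :* r) := (m :* r) :* z) refl (nat (n !)) z (recip (n !)))
        (trans (*-congʳ (recip-inverse (n !))) (*-identityˡ z))

    -- `X` has no inverse for the convolution, but it moves entry n to place n + 1 with the
    -- invertible factor n + 1.
    X⋆-cancel : ∀ a b → X ⋆ a ≐ X ⋆ b → a ≐ b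
    X⋆-cancel a b eq n = nat-*-cancel (suc n)
      (trans (sym (X⋆-suc a n)) (trans (eq (suc n)) (X⋆-suc b n)))

    -- b is a sequence Bₙ(x), and μₙ stands for ∫ (y + t)ⁿ dt over [0, 1].
    module BernoulliSequence
      (b : Sequence) (x : Carrier) (bernoulli : b ⋆ expm1 ≐ X ⋆ (x ^_))
      (μ : Sequence) (y : Carrier)
      (moment : ∀ n → nat (suc n) * μ n + y ^ suc n ≈ (y + 1#) ^ suc n)
      where

      -- In generating functions: u times the integral of e^((y+t)u) over t in [0, 1] is e^(yu) (e^u
      -- - 1).
      X⋆μ : X ⋆ μ ≐ (y ^_) ⋆ expm1
      X⋆μ zero    = trans (zeroˡ (μ 0)) (sym (zeroʳ 1#))
      X⋆μ (suc n) = +-cancelʳ (y ^ suc n) _ _ (begin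
        (X ⋆ μ) (suc n) + y ^ suc n                   ≈⟨ +-congʳ (X⋆-suc μ n) ⟩
        nat (suc n) * μ n + y ^ suc n                 ≈⟨ moment n ⟩
        (y + 1#) ^ suc n                              ≈⟨ ^-⋆ y 1# (suc n) ⟨
        ((y ^_) ⋆ (1# ^_)) (suc n)                    ≈⟨ ⋆-comm (y ^_) (1# ^_) (suc n) ⟩
        ((1# ^_) ⋆ (y ^_)) (suc n)                    ≈⟨ ⋆-congʳ ones≐ (suc n) ⟨
        (ones ⋆ (y ^_)) (suc n)                       ≈⟨ expm1-⋆ (y ^_) (suc n) ⟨
        (expm1 ⋆ (y ^_)) (suc n) + y ^ suc n          ≈⟨ +-congʳ (⋆-comm expm1 (y ^_) (suc n)) ⟩
        ((y ^_) ⋆ expm1) (suc n) + y ^ suc n          ∎)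

      -- The integral of Bₙ over [x + y, x + y + 1].
      b⋆μ : ∀ n → (b ⋆ μ) n ≈ (x + y) ^ n
      -- Multiplied by `X`, the moments release a factor `expm1`, which `b` absorbs to give back
      -- `X`.
      b⋆μ = X⋆-cancel (b ⋆ μ) ((x + y) ^_) λ n → begin
        (X ⋆ (b ⋆ μ)) n                ≈⟨ ⋆-swap X b μ n ⟩
        (b ⋆ (X ⋆ μ)) n                ≈⟨ ⋆-congˡ X⋆μ n ⟩
        (b ⋆ ((y ^_) ⋆ expm1)) n       ≈⟨ ⋆-swap b (y ^_) expm1 n ⟩
        ((y ^_) ⋆ (b ⋆ expm1)) n       ≈⟨ ⋆-congˡ bernoulli n ⟩
        ((y ^_) ⋆ (X ⋆ (x ^_))) n      ≈⟨ ⋆-swap (y ^_) X (x ^_) n ⟩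
        (X ⋆ ((y ^_) ⋆ (x ^_))) n      ≈⟨ ⋆-congˡ (⋆-comm (y ^_) (x ^_)) n ⟩
        (X ⋆ ((x ^_) ⋆ (y ^_))) n      ≈⟨ ⋆-congˡ (^-⋆ x y) n ⟩
        (X ⋆ ((x + y) ^_)) n           ∎

      -- The factor n + 1 is a convolution with `X`; `bernoulli` replaces `X ⋆ (x ^_)` by
      -- `b ⋆ expm1`, and the freed `expm1` raises column m to column m + 1.
      nat*S : ∀ m n → nat (suc n) * ((x ^_) ⋆ S m) n ≈ nat (suc m) * (b ⋆ S (suc m)) (suc n)
      nat*S m n = begin
        nat (suc n) * ((x ^_) ⋆ S m) n               ≈⟨ X⋆-suc ((x ^_) ⋆ S m) n ⟨
        (X ⋆ ((x ^_) ⋆ S m)) (suc n)                 ≈⟨ ⋆-assoc X (x ^_) (S m) (suc n) ⟨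
        ((X ⋆ (x ^_)) ⋆ S m) (suc n)                 ≈⟨ ⋆-congʳ bernoulli (suc n) ⟨
        ((b ⋆ expm1) ⋆ S m) (suc n)                  ≈⟨ ⋆-assoc b expm1 (S m) (suc n) ⟩
        (b ⋆ (expm1 ⋆ S m)) (suc n)                  ≈⟨ ⋆-congˡ (expm1⋆S m) (suc n) ⟩
        (b ⋆ (λ k → nat (suc m) * S (suc m) k)) (suc n)  ≈⟨ ⋆-*ˡ (nat (suc m)) b (S (suc m)) (suc n) ⟩
        nat (suc m) * (b ⋆ S (suc m)) (suc n)        ∎

      -- Since `S 0` is `δ` and `a 0` is 1, the isolated `b (suc n)` is the term m = 0 of the sum of
      -- `a m` times `b ⋆ S m`. The whole sum is then b convolved with the moments.
      bernoulli-stirling : ∀ (a : Sequence) n →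
        (∀ k → k ℕ.≤ suc n → Σ< (suc (suc n)) (λ m → a m * S m k) ≈ μ k) → a 0 ≈ 1# →
        b (suc n) + nat (suc n) * Σ< (suc n) (λ i → (a (suc i) * recip (suc i)) * ((x ^_) ⋆ S i) n) ≈
        (x + y) ^ suc n
      bernoulli-stirling a n hyp a₀ = begin
        b (suc n) + nat (suc n) * Σ< (suc n) (λ i → (a (suc i) * recip (suc i)) * ((x ^_) ⋆ S i) n)
          ≈⟨ +-congˡ (*-distribˡ-Σ< (suc n) (nat (suc n)) λ i → (a (suc i) * recip (suc i)) * ((x ^_) ⋆ S i) n) ⟩
        b (suc n) + Σ< (suc n) (λ i → nat (suc n) * ((a (suc i) * recip (suc i)) * ((x ^_) ⋆ S i) n))
          ≈⟨ +-congˡ (Σ<-cong (suc n) λ i _ → term i) ⟩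
        b (suc n) + Σ< (suc n) (λ i → (b ⋆ (λ k → a (suc i) * S (suc i) k)) (suc n))
          ≈⟨ +-congʳ head ⟨
        Σ< (suc (suc n)) (λ m → (b ⋆ (λ k → a m * S m k)) (suc n))
          ≈⟨ ⋆-Σ< b (suc (suc n)) (λ m k → a m * S m k) (suc n) ⟨
        (b ⋆ (λ k → Σ< (suc (suc n)) (λ m → a m * S m k))) (suc n)
          ≈⟨ ⋆-cong-≤ (suc n) (λ _ _ → refl) hyp ⟩
        (b ⋆ μ) (suc n)
          ≈⟨ b⋆μ (suc n) ⟩
        (x + y) ^ suc n
          ∎
        where
        head : (b ⋆ (λ k → a 0 * S 0 k)) (suc n) ≈ b (suc n)
        head = begin
          (b ⋆ (λ k → a 0 * S 0 k)) (suc n)   ≈⟨ ⋆-congˡ (λ k → trans (*-congʳ a₀) (trans (*-identityˡ _) (S0≐δ k))) (suc n) ⟩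
          (b ⋆ δ) (suc n)                     ≈⟨ ⋆-comm b δ (suc n) ⟩
          (δ ⋆ b) (suc n)                     ≈⟨ ⋆-identityˡ b (suc n) ⟩
          b (suc n)                           ∎
        term : ∀ i → nat (suc n) * ((a (suc i) * recip (suc i)) * ((x ^_) ⋆ S i) n) ≈
                     (b ⋆ (λ k → a (suc i) * S (suc i) k)) (suc n)
        term i = begin
          nat (suc n) * ((a (suc i) * recip (suc i)) * ((x ^_) ⋆ S i) n)
            ≈⟨ solve 4 (λ n c r s → n :* ((c :* r) :* s) := (c :* r) :* (n :* s)) refl _ _ _ _ ⟩
          (a (suc i) * recip (suc i)) * (nat (suc n) * ((x ^_) ⋆ S i) n)
            ≈⟨ *-congˡ (nat*S i n) ⟩
          (a (suc i) * recip (suc i)) * (nat (suc i) * (b ⋆ S (suc i)) (suc n))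
            ≈⟨ solve 4 (λ c r m s → (c :* r) :* (m :* s) := c :* ((m :* r) :* s)) refl _ _ _ _ ⟩
          a (suc i) * ((nat (suc i) * recip (suc i)) * (b ⋆ S (suc i)) (suc n))
            ≈⟨ *-congˡ (trans (*-congʳ (recip-inverse (suc i))) (*-identityˡ _)) ⟩
          a (suc i) * (b ⋆ S (suc i)) (suc n)
            ≈⟨ ⋆-*ˡ (a (suc i)) b (S (suc i)) (suc n) ⟨
          (b ⋆ (λ k → a (suc i) * S (suc i) k)) (suc n)
            ∎

-- Estimates for power sums

powerSum : ℕ → ℕ → ℕ
powerSum k zero    = 0
powerSum k (suc n) = powerSum k n ℕ.+ n ℕ.^ k

module _ where
  open ℕ.≤-Reasoning
  open ℕSolver.+-*-Solver

  -- With `^-suc-≤`, a discrete mean value estimate: the increment of the power k + 1 from a to a +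
  -- 1 lies between (k+1) aᵏ and (k+1) (a+1)ᵏ. Sums replace differences to stay in ℕ.
  ^-suc-≥ : ∀ a k → a ℕ.^ suc k ℕ.+ suc k ℕ.* a ℕ.^ k ℕ.≤ suc a ℕ.^ suc k
  ^-suc-≥ a zero    = ℕ.≤-reflexive
    (solve 1 (λ a → a :* con 1 :+ con 1 :* con 1 := (con 1 :+ a) :* con 1) ≡.refl a)
  ^-suc-≥ a (suc k) = begin
    a ℕ.* (a ℕ.* p) ℕ.+ suc (suc k) ℕ.* (a ℕ.* p)
      ≡⟨ solve 3 (λ a k p → a :* (a :* p) :+ (con 2 :+ k) :* (a :* p) :=
           a :* p :+ a :* (a :* p :+ (con 1 :+ k) :* p)) ≡.refl a k p ⟩
    a ℕ.* p ℕ.+ a ℕ.* (a ℕ.* p ℕ.+ suc k ℕ.* p)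
      ≤⟨ ℕ.+-mono-≤ (ℕ.^-monoˡ-≤ (suc k) (ℕ.n≤1+n a)) (ℕ.*-monoʳ-≤ a (^-suc-≥ a k)) ⟩
    suc a ℕ.* suc a ℕ.^ suc k
      ∎
    where p = a ℕ.^ k

  ^-suc-≤ : ∀ a k → suc a ℕ.^ suc k ℕ.≤ a ℕ.^ suc k ℕ.+ suc k ℕ.* suc a ℕ.^ k
  ^-suc-≤ a zero    = ℕ.≤-reflexive
    (solve 1 (λ a → (con 1 :+ a) :* con 1 := a :* con 1 :+ con 1 :* con 1) ≡.refl a)
  ^-suc-≤ a (suc k) = begin
    q ℕ.+ a ℕ.* q
      ≤⟨ ℕ.+-monoʳ-≤ q (ℕ.*-monoʳ-≤ a (^-suc-≤ a k)) ⟩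
    q ℕ.+ a ℕ.* (a ℕ.^ suc k ℕ.+ suc k ℕ.* suc a ℕ.^ k)
      ≡⟨ solve 5 (λ q a p k r → q :+ a :* (p :+ (con 1 :+ k) :* r) := a :* p :+ (q :+ (con 1 :+ k) :* (a :* r)))
           ≡.refl q a (a ℕ.^ suc k) k (suc a ℕ.^ k) ⟩
    a ℕ.^ suc (suc k) ℕ.+ (q ℕ.+ suc k ℕ.* (a ℕ.* suc a ℕ.^ k))
      ≤⟨ ℕ.+-monoʳ-≤ (a ℕ.^ suc (suc k)) (ℕ.+-monoʳ-≤ q (ℕ.*-monoʳ-≤ (suc k) (ℕ.*-monoˡ-≤ (suc a ℕ.^ k) (ℕ.n≤1+n a)))) ⟩
    a ℕ.^ suc (suc k) ℕ.+ suc (suc k) ℕ.* q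
      ∎
    where q = suc a ℕ.^ suc k

  powerSum-≤ : ∀ k n → suc k ℕ.* powerSum k n ℕ.≤ n ℕ.^ suc k
  powerSum-≤ k zero    = ℕ.≤-reflexive (ℕ.*-zeroʳ (suc k))
  powerSum-≤ k (suc n) = begin
    suc k ℕ.* (powerSum k n ℕ.+ n ℕ.^ k)              ≡⟨ ℕ.*-distribˡ-+ (suc k) (powerSum k n) (n ℕ.^ k) ⟩
    suc k ℕ.* powerSum k n ℕ.+ suc k ℕ.* n ℕ.^ k      ≤⟨ ℕ.+-monoˡ-≤ _ (powerSum-≤ k n) ⟩
    n ℕ.^ suc k ℕ.+ suc k ℕ.* n ℕ.^ k                 ≤⟨ ^-suc-≥ n k ⟩
    suc n ℕ.^ suc k                                   ∎

  -- Telescoping again, now with the upper estimate. The additional term nᵏ is what becomes the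
  -- error 1/n after scaling.
  powerSum-≥ : ∀ k n → n ℕ.^ suc k ℕ.≤ suc k ℕ.* (powerSum k n ℕ.+ n ℕ.^ k)
  powerSum-≥ k zero    = ℕ.z≤n
  powerSum-≥ k (suc n) = begin
    suc n ℕ.^ suc k                                                  ≤⟨ ^-suc-≤ n k ⟩
    n ℕ.^ suc k ℕ.+ suc k ℕ.* suc n ℕ.^ k                            ≤⟨ ℕ.+-monoˡ-≤ _ (powerSum-≥ k n) ⟩
    suc k ℕ.* powerSum k (suc n) ℕ.+ suc k ℕ.* suc n ℕ.^ k           ≡⟨ ℕ.*-distribˡ-+ (suc k) (powerSum k (suc n)) (suc n ℕ.^ k) ⟨
    suc k ℕ.* (powerSum k (suc n) ℕ.+ suc n ℕ.^ k)                   ∎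

-- Natural numbers and unit fractions in ℚ

natℚ : ℕ → ℚ
natℚ n = + n ℚ./ 1

recipℚ : ∀ n .{{_ : NonZero n}} → ℚ
recipℚ n = + 1 ℚ./ n

natℚ-suc : ∀ n → natℚ (suc n) ≡ 1ℚ ℚ.+ natℚ n
natℚ-suc n = ℚ.toℚᵘ-injective (ℚᵘ.≃-trans (ℚ.toℚᵘ-fromℚᵘ (mkℚᵘ (+ suc n) 0))
  (ℚᵘ.≃-sym (ℚᵘ.≃-trans (ℚ.toℚᵘ-homo-+ 1ℚ (natℚ n))
    (ℚᵘ.≃-trans (ℚᵘ.+-congʳ (mkℚᵘ (+ 1) 0) (ℚ.toℚᵘ-fromℚᵘ (mkℚᵘ (+ n) 0)))
      (*≡* (solve 1 (λ n → (con (+ 1) :+ n :* con (+ 1)) :* con (+ 1) := (con (+ 1) :+ n) :* con (+ 1)) ≡.refl (+ n)))))))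
  where open ℤSolver.+-*-Solver

recipℚ-inverse : ∀ n .{{_ : NonZero n}} → natℚ n ℚ.* recipℚ n ≡ 1ℚ
recipℚ-inverse (suc n) = ℚ.toℚᵘ-injective (ℚᵘ.≃-trans (ℚ.toℚᵘ-homo-* (natℚ (suc n)) (recipℚ (suc n)))
  (ℚᵘ.≃-trans (ℚᵘ.*-cong (ℚ.toℚᵘ-fromℚᵘ (mkℚᵘ (+ suc n) 0)) (ℚ.toℚᵘ-fromℚᵘ (mkℚᵘ (+ 1) n)))
    (*≡* (≡.cong +_ (ℕSolver.+-*-Solver.solve 1 (λ n → (n :* con 1) :* con 1 := con 1 :* (con 1 :* n)) ≡.refl (suc n))))))
  where open ℕSolver.+-*-Solver

natℚ-nonNeg : ∀ n → 0ℚ ℚ.≤ natℚ n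
natℚ-nonNeg n = ℚ.nonNegative⁻¹ (natℚ n) {{ℚ.normalize-nonNeg n 1}}

recipℚ-pos : ∀ n .{{_ : NonZero n}} → 0ℚ ℚ.< recipℚ n
recipℚ-pos n = ℚ.positive⁻¹ (recipℚ n) {{ℚ.normalize-pos 1 n}}

module ℚC = Convolution ℚ.+-*-commutativeRing natℚ ≡.refl natℚ-suc

natℚ-mono : ∀ {m n} → m ℕ.≤ n → natℚ m ℚ.≤ natℚ n
natℚ-mono {m} {n} m≤n = begin
  natℚ m                            ≡⟨ ℚ.+-identityʳ (natℚ m) ⟨
  natℚ m ℚ.+ 0ℚ                     ≤⟨ ℚ.+-monoʳ-≤ (natℚ m) (natℚ-nonNeg (n ℕ.∸ m)) ⟩
  natℚ m ℚ.+ natℚ (n ℕ.∸ m)         ≡⟨ ℚC.nat-+ m (n ℕ.∸ m) ⟨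
  natℚ (m ℕ.+ (n ℕ.∸ m))            ≡⟨ ≡.cong natℚ (ℕ.m+[n∸m]≡n m≤n) ⟩
  natℚ n                            ∎
  where open ℚ.≤-Reasoning

recipℚ-small : ∀ ε → 0ℚ ℚ.< ε → ∃[ N ] (∀ n → N ℕ.≤ n → recipℚ (suc n) ℚ.≤ ε)
recipℚ-small ε@(mkℚ (+ zero) _ _)  0<ε = ⊥-elim (ℚ.<-irrefl (ℚ.≃⇒≡ (ℚ.*≡* ≡.refl)) 0<ε)
recipℚ-small ε@(mkℚ (ℤ.-[1+ _ ]) _ _) 0<ε with ℚ.positive 0<ε
... | ()
-- Here ε = (p+1)/(d+1), which is at least 1/(d+1); so d itself is a valid threshold.
recipℚ-small ε@(mkℚ (+ suc p) d _) 0<ε = d , λ n d≤n → ℚ.toℚᵘ-cancel-≤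
  (ℚᵘ.≤-respˡ-≃ (ℚᵘ.≃-sym (ℚ.toℚᵘ-fromℚᵘ (mkℚᵘ (+ 1) n)))
    (*≤* (ℤ.+≤+ (ℕ.≤-trans (ℕ.≤-reflexive (ℕ.+-identityʳ (suc d)))
      (ℕ.≤-trans (ℕ.s≤s d≤n) (ℕ.m≤m+n (suc n) (p ℕ.* suc n)))))))

-- Left Riemann sums of powers

-- The left Riemann sum of g for the partition of [0, 1] into n + 1 equal parts.
leftSum : (ℚ → ℚ) → ℕ → ℚ
leftSum g n = ℚC.Σ< (suc n) (λ i → g (natℚ i ℚ.* recipℚ (suc n)) ℚ.* recipℚ (suc n))

leftSum-cong : ∀ {f g} → (∀ q → f q ≡ g q) → ∀ n → leftSum f n ≡ leftSum g n
leftSum-cong f≗g n = ℚC.Σ<-cong (suc n) λ i _ → ≡.cong (ℚ._* recipℚ (suc n)) (f≗g (natℚ i ℚ.* recipℚ (suc n)))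

leftSum-*ˡ : ∀ x g n → leftSum (λ q → x ℚ.* g q) n ≡ x ℚ.* leftSum g n
leftSum-*ˡ x g n = ≡.trans
  (ℚC.Σ<-cong (suc n) λ i _ → ℚ.*-assoc x (g (natℚ i ℚ.* recipℚ (suc n))) (recipℚ (suc n)))
  (≡.sym (ℚC.*-distribˡ-Σ< (suc n) x (λ i → g (natℚ i ℚ.* recipℚ (suc n)) ℚ.* recipℚ (suc n))))

leftSum-Σ< : ∀ m (g : ℕ → ℚ → ℚ) n →
             leftSum (λ q → ℚC.Σ< m (λ j → g j q)) n ≡ ℚC.Σ< m (λ j → leftSum (g j) n)
leftSum-Σ< m g n = ≡.trans
  (ℚC.Σ<-cong (suc n) λ i _ → ℚC.*-distribʳ-Σ< m (recipℚ (suc n)) (λ j → g j (natℚ i ℚ.* recipℚ (suc n))))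
  (ℚC.Σ<-comm (suc n) m (λ i j → g j (natℚ i ℚ.* recipℚ (suc n)) ℚ.* recipℚ (suc n)))

1^ℚ : ∀ n → 1ℚ ^ℚ n ≡ 1ℚ
1^ℚ n = ≡.sym (ℚC.ones≐ n)

^ℚ-nonNeg : ∀ {h} → 0ℚ ℚ.≤ h → ∀ k → 0ℚ ℚ.≤ h ^ℚ k
^ℚ-nonNeg 0≤h zero    = ℚ.nonNegative⁻¹ 1ℚ
^ℚ-nonNeg {h} 0≤h (suc k) = ≡.subst (ℚ._≤ h ℚ.* h ^ℚ k) (ℚ.*-zeroʳ h)
  (ℚ.*-monoˡ-≤-nonNeg h {{ℚ.nonNegative 0≤h}} (^ℚ-nonNeg 0≤h k))

Σ<-powers : ∀ h k n →
  ℚC.Σ< n (λ i → (natℚ i ℚ.* h) ^ℚ k ℚ.* h) ≡ natℚ (powerSum k n) ℚ.* h ^ℚ suc k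
Σ<-powers h k zero    = ≡.sym (ℚ.*-zeroˡ (h ^ℚ suc k))
Σ<-powers h k (suc n) = begin
  ℚC.Σ< (suc n) (λ i → (natℚ i ℚ.* h) ^ℚ k ℚ.* h)
    ≡⟨ ℚC.Σ<-last n (λ i → (natℚ i ℚ.* h) ^ℚ k ℚ.* h) ⟩
  ℚC.Σ< n (λ i → (natℚ i ℚ.* h) ^ℚ k ℚ.* h) ℚ.+ (natℚ n ℚ.* h) ^ℚ k ℚ.* h
    ≡⟨ ≡.cong₂ ℚ._+_ (Σ<-powers h k n) (≡.cong (ℚ._* h) (^ℚ-distrib-* (natℚ n) h k)) ⟩
  natℚ (powerSum k n) ℚ.* (h ℚ.* h ^ℚ k) ℚ.+ (natℚ n ^ℚ k ℚ.* h ^ℚ k) ℚ.* h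
    ≡⟨ solve 4 (λ s h p q → s :* (h :* p) :+ (q :* p) :* h := (s :+ q) :* (h :* p)) ≡.refl (natℚ (powerSum k n)) h (h ^ℚ k) (natℚ n ^ℚ k) ⟩
  (natℚ (powerSum k n) ℚ.+ natℚ n ^ℚ k) ℚ.* h ^ℚ suc k
    ≡⟨ ≡.cong (λ p → (natℚ (powerSum k n) ℚ.+ p) ℚ.* h ^ℚ suc k) (ℚC.nat-^ n k) ⟨
  (natℚ (powerSum k n) ℚ.+ natℚ (n ℕ.^ k)) ℚ.* h ^ℚ suc k
    ≡⟨ ≡.cong (ℚ._* h ^ℚ suc k) (ℚC.nat-+ (powerSum k n) (n ℕ.^ k)) ⟨
  natℚ (powerSum k (suc n)) ℚ.* h ^ℚ suc k
    ∎
  where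
  open ≡.≡-Reasoning
  open +-*-Solver

-- A squeeze r ≤ 1/(k+1) ≤ r + h. Multiplied by k + 1, the two inequalities are the power sum bounds
-- for N = n + 1 scaled by h^(k+1); the term Nᵏ contributes exactly (N h)ᵏ h = h.
leftSum-power : ∀ k n → ℚ.∣ leftSum (_^ℚ k) n ℚ.- recipℚ (suc k) ∣ ℚ.≤ recipℚ (suc n)
leftSum-power k n = begin
  ℚ.∣ r ℚ.- s ∣            ≡⟨ ℚ.∣-p∣≡∣p∣ (r ℚ.- s) ⟨
  ℚ.∣ ℚ.- (r ℚ.- s) ∣      ≡⟨ ≡.cong ℚ.∣_∣ (solve 2 (λ r s → :- (r :- s) := s :- r) ≡.refl r s) ⟩
  ℚ.∣ s ℚ.- r ∣            ≡⟨ ℚ.0≤p⇒∣p∣≡p (≡.subst (ℚ._≤ s ℚ.- r) (ℚ.+-inverseʳ r) (ℚ.+-monoˡ-≤ (ℚ.- r) r≤s)) ⟩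
  s ℚ.- r                  ≤⟨ ℚ.+-monoˡ-≤ (ℚ.- r) s≤r+h ⟩
  (r ℚ.+ h) ℚ.- r          ≡⟨ solve 2 (λ r h → (r :+ h) :- r := h) ≡.refl r h ⟩
  h                        ∎
  where
  open ℚ.≤-Reasoning
  open +-*-Solver
  N = suc n
  P = powerSum k N
  h = recipℚ N
  K = natℚ (suc k)
  r = leftSum (_^ℚ k) n
  s = recipℚ (suc k)
  H = h ^ℚ suc k
  r≡ : r ≡ natℚ P ℚ.* H
  r≡ = Σ<-powers h k N
  instance
    H-nonNeg : ℚ.NonNegative H
    H-nonNeg = ℚ.nonNegative (^ℚ-nonNeg (ℚ.<⇒≤ (recipℚ-pos N)) (suc k))
    K-pos : ℚ.Positive K
    K-pos = ℚ.normalize-pos (suc k) 1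
  Nh : ∀ j → natℚ (N ℕ.^ j) ℚ.* h ^ℚ j ≡ 1ℚ
  Nh j = begin-equality
    natℚ (N ℕ.^ j) ℚ.* h ^ℚ j     ≡⟨ ≡.cong (ℚ._* h ^ℚ j) (ℚC.nat-^ N j) ⟩
    natℚ N ^ℚ j ℚ.* h ^ℚ j        ≡⟨ ^ℚ-distrib-* (natℚ N) h j ⟨
    (natℚ N ℚ.* h) ^ℚ j           ≡⟨ ≡.cong (_^ℚ j) (recipℚ-inverse N) ⟩
    1ℚ ^ℚ j                       ≡⟨ 1^ℚ j ⟩
    1ℚ                            ∎
  r≤s : r ℚ.≤ s
  r≤s = ℚ.*-cancelˡ-≤-pos K (begin
    K ℚ.* r                             ≡⟨ ≡.cong (K ℚ.*_) r≡ ⟩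
    K ℚ.* (natℚ P ℚ.* H)                ≡⟨ ℚ.*-assoc K (natℚ P) H ⟨
    (K ℚ.* natℚ P) ℚ.* H                ≡⟨ ≡.cong (ℚ._* H) (ℚC.nat-* (suc k) P) ⟨
    natℚ (suc k ℕ.* P) ℚ.* H            ≤⟨ ℚ.*-monoʳ-≤-nonNeg H (natℚ-mono (powerSum-≤ k N)) ⟩
    natℚ (N ℕ.^ suc k) ℚ.* H            ≡⟨ Nh (suc k) ⟩
    1ℚ                                  ≡⟨ recipℚ-inverse (suc k) ⟨
    K ℚ.* s                             ∎)
  s≤r+h : s ℚ.≤ r ℚ.+ h
  s≤r+h = ℚ.*-cancelˡ-≤-pos K (begin
    K ℚ.* s                                            ≡⟨ recipℚ-inverse (suc k) ⟩
    1ℚ                                                 ≡⟨ Nh (suc k) ⟨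
    natℚ (N ℕ.^ suc k) ℚ.* H                           ≤⟨ ℚ.*-monoʳ-≤-nonNeg H (natℚ-mono (powerSum-≥ k N)) ⟩
    natℚ (suc k ℕ.* (P ℕ.+ N ℕ.^ k)) ℚ.* H             ≡⟨ ≡.cong (ℚ._* H) (≡.trans (ℚC.nat-* (suc k) (P ℕ.+ N ℕ.^ k)) (≡.cong (K ℚ.*_) (ℚC.nat-+ P (N ℕ.^ k)))) ⟩
    (K ℚ.* (natℚ P ℚ.+ natℚ (N ℕ.^ k))) ℚ.* H          ≡⟨ solve 5 (λ K P Q h p → (K :* (P :+ Q)) :* (h :* p) := K :* (P :* (h :* p) :+ (Q :* p) :* h)) ≡.refl K (natℚ P) (natℚ (N ℕ.^ k)) h (h ^ℚ k) ⟩
    K ℚ.* (natℚ P ℚ.* H ℚ.+ (natℚ (N ℕ.^ k) ℚ.* h ^ℚ k) ℚ.* h)  ≡⟨ ≡.cong (K ℚ.*_) (≡.cong₂ ℚ._+_ (≡.sym r≡) (≡.trans (≡.cong (ℚ._* h) (Nh k)) (ℚ.*-identityˡ h))) ⟩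
    K ℚ.* (r ℚ.+ h)                                    ∎)

leftSum-power-null : ∀ σ k →
  Null (λ n → leftSum (λ q → (σ ℚ.* q) ^ℚ k) n ℚ.- σ ^ℚ k ℚ.* recipℚ (suc k))
leftSum-power-null σ k = null-resp
  (λ n → ≡.sym (≡.trans
    (≡.cong (ℚ._- σ ^ℚ k ℚ.* recipℚ (suc k))
      (≡.trans (leftSum-cong (λ q → ^ℚ-distrib-* σ q k) n) (leftSum-*ˡ (σ ^ℚ k) (_^ℚ k) n)))
    (solve 3 (λ a b c → a :* b :- a :* c := a :* (b :- c)) ≡.refl (σ ^ℚ k) (leftSum (_^ℚ k) n) (recipℚ (suc k)))))
  (null-* (bounded (fromℚ (σ ^ℚ k))) λ ε 0<ε →
    proj₁ (recipℚ-small ε 0<ε) , λ n n≥ → ℚ.≤-trans (leftSum-power k n) (proj₂ (recipℚ-small ε 0<ε) n n≥))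
  where
  open +-*-Solver

-- The formulas over an abstract ring with limits

-- The ring is a parameter, together with the operations in which the
-- formulas are stated: unification of real numbers would unfold them down
-- to their Cauchy moduli.
module CauchyNumberFormulas
  {c ℓ} {A : Set c} {_≋_ : Rel A ℓ} {_⊕_ _⊗_ : Op₂ A} {⊝_ : Op₁ A} {𝟘 𝟙 : A}
  (isCommutativeRing : IsCommutativeRing _≋_ _⊕_ _⊗_ ⊝_ 𝟘 𝟙)
  (ι : ℚ → A) (ι-zero : ι 0ℚ ≋ 𝟘) (ι-one : ι 1ℚ ≋ 𝟙)
  (ι-+ : ∀ p q → ι (p ℚ.+ q) ≋ (ι p ⊕ ι q)) (ι-* : ∀ p q → ι (p ℚ.* q) ≋ (ι p ⊗ ι q))
  {ℓ′} (_⇝_ : (ℕ → ℚ) → A → Set ℓ′)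
  (⇝-unique : ∀ {r x y} → r ⇝ x → r ⇝ y → x ≋ y)
  (⇝-resp-≗ : ∀ {r s x} → (∀ n → r n ≡ s n) → r ⇝ x → s ⇝ x)
  (⇝-null : ∀ {r q} → Null (λ n → r n ℚ.- q) → r ⇝ ι q)
  (⇝-zero : (λ _ → 0ℚ) ⇝ 𝟘)
  (⇝-+ : ∀ {r s x y} → r ⇝ x → s ⇝ y → (λ n → r n ℚ.+ s n) ⇝ (x ⊕ y))
  (⇝-*ˡ : ∀ q {r x} → r ⇝ x → (λ n → q ℚ.* r n) ⇝ (ι q ⊗ x))
  where

  R : CommutativeRing c ℓ
  R = record { isCommutativeRing = isCommutativeRing }

  open CommutativeRing R hiding (isCommutativeRing)

  nat : ℕ → Carrier
  nat n = ι (natℚ n)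

  recip : ∀ n .{{_ : NonZero n}} → Carrier
  recip n = ι (recipℚ n)

  nat-suc : ∀ n → nat (suc n) ≈ 1# + nat n
  nat-suc n = trans (reflexive (≡.cong ι (natℚ-suc n))) (trans (ι-+ 1ℚ (natℚ n)) (+-congʳ ι-one))

  recip-inverse : ∀ n .{{_ : NonZero n}} → nat n * recip n ≈ 1#
  recip-inverse n = trans (sym (ι-* (natℚ n) (recipℚ n)))
    (trans (reflexive (≡.cong ι (recipℚ-inverse n))) ι-one)

  open Convolution R nat ι-zero nat-suc public
  open Reciprocals recip recip-inverse public
  open import Algebra.Properties.Semiring.Exp semiring public using (_^_; ^-congˡ)
  open import Relation.Binary.Reasoning.Setoid setoid

  ι-^ : ∀ p n → ι (p ^ℚ n) ≈ ι p ^ n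
  ι-^ p zero    = ι-one
  ι-^ p (suc n) = trans (ι-* p (p ^ℚ n)) (*-congˡ (ι-^ p n))

  ⇝-Σ< : ∀ m {r : ℕ → ℕ → ℚ} {x : ℕ → Carrier} → (∀ i → r i ⇝ x i) →
         (λ n → ℚC.Σ< m (λ i → r i n)) ⇝ Σ< m x
  ⇝-Σ< zero    p = ⇝-zero
  ⇝-Σ< (suc m) p = ⇝-+ (p 0) (⇝-Σ< m (p ∘ suc))

  module Statement
    (pow : A → ℕ → A) (pow≈ : ∀ x n → pow x n ≋ (x ^ n))
    (fromℕ : ℕ → A) (fromℕ≈ : ∀ n → fromℕ n ≋ ι (natℚ n))
    (sub : Op₂ A) (sub≈ : ∀ x y → sub x y ≋ (x ⊕ (⊝ y)))
    (sum₀ : ℕ → (ℕ → A) → A) (sum₀≈ : ∀ n f → sum₀ n f ≋ Σ< (suc n) f)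
    (sum₁ : ℕ → ((m : ℕ) .{{_ : NonZero m}} → A) → A)
    (sum₁≈ : ∀ n f → sum₁ n f ≋ Σ< n (λ i → f (suc i)))
    (conv : (ℕ → A) → (ℕ → A) → ℕ → A)
    (conv≈ : ∀ f g n → conv f g n ≋ sum₀ n (λ i → f i ⊗ g (n ∸ i)))
    (gS : ℕ → ℕ → A → A)
    (gS≈ : ∀ n m x → gS n m x ≋ sum₀ (n ∸ m) (λ i → fromℕ ((n C i) ℕ.* stirling₂ (n ∸ i) m) ⊗ pow x i))
    (div : A → (n : ℕ) .{{_ : NonZero n}} → A)
    (div≈ : ∀ x n .{{_ : NonZero n}} → div x n ≋ (x ⊗ ι (recipℚ n)))
    where

    -- With a m standing for ∫ (σt)(σt - 1)⋯(σt - m + 1) over [0, 1], the powers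
    -- of σ and y are related by ∫ (σt)ⁿ = ∫ (y + t)ⁿ: σ = 1, y = 0 for the first
    -- kind and σ = -1, y = -1 for the second.
    module Formula
      (σ y : ℚ) (σ-y : ∀ n → σ ^ℚ n ℚ.+ y ^ℚ suc n ≡ (y ℚ.+ 1ℚ) ^ℚ suc n)
      (a : ℕ → Carrier) (a-integral : ∀ m → leftSum (λ q → ℚC.falling (σ ℚ.* q) m) ⇝ a m)
      where

      g : ℕ → ℚ → ℚ
      g m q = ℚC.falling (σ ℚ.* q) m

      μ : ℕ → Carrier
      μ n = ι (σ ^ℚ n ℚ.* recipℚ (suc n))

      -- `σ-y` is the equality of the integrals of (σt)ⁿ and (y + t)ⁿ with the denominator n + 1
      -- cleared.
      moment : ∀ n → nat (suc n) * μ n + ι y ^ suc n ≈ (ι y + 1#) ^ suc n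
      moment n = begin
        nat (suc n) * μ n + ι y ^ suc n
          ≈⟨ +-cong (ι-* (natℚ (suc n)) (σ ^ℚ n ℚ.* recipℚ (suc n))) (ι-^ y (suc n)) ⟨
        ι (natℚ (suc n) ℚ.* (σ ^ℚ n ℚ.* recipℚ (suc n))) + ι (y ^ℚ suc n)
          ≈⟨ ι-+ (natℚ (suc n) ℚ.* (σ ^ℚ n ℚ.* recipℚ (suc n))) (y ^ℚ suc n) ⟨
        ι (natℚ (suc n) ℚ.* (σ ^ℚ n ℚ.* recipℚ (suc n)) ℚ.+ y ^ℚ suc n)
          ≡⟨ ≡.cong ι (≡.trans (≡.cong (ℚ._+ y ^ℚ suc n) cancel) (σ-y n)) ⟩
        ι ((y ℚ.+ 1ℚ) ^ℚ suc n)
          ≈⟨ ι-^ (y ℚ.+ 1ℚ) (suc n) ⟩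
        ι (y ℚ.+ 1ℚ) ^ suc n
          ≈⟨ ^-congˡ (suc n) (trans (ι-+ y 1ℚ) (+-congˡ ι-one)) ⟩
        (ι y + 1#) ^ suc n
          ∎
        where
        open +-*-Solver using (solve; _:*_; _:=_)
        cancel : natℚ (suc n) ℚ.* (σ ^ℚ n ℚ.* recipℚ (suc n)) ≡ σ ^ℚ n
        cancel = ≡.trans
          (solve 3 (λ m s r → m :* (s :* r) := s :* (m :* r)) ≡.refl (natℚ (suc n)) (σ ^ℚ n) (recipℚ (suc n)))
          (≡.trans (≡.cong (σ ^ℚ n ℚ.*_) (recipℚ-inverse (suc n))) (ℚ.*-identityʳ (σ ^ℚ n)))

      moments : ∀ M k → k ℕ.< M → Σ< M (λ m → a m * S m k) ≈ μ k
      moments M k k<M = trans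
        (Σ<-cong M λ m _ → *-comm (a m) (S m k))
        (⇝-unique
          (⇝-resp-≗ expand (⇝-Σ< M λ m → ⇝-*ˡ (ℚC.S m k) (a-integral m)))
          (⇝-null (leftSum-power-null σ k)))
        where
        -- Linearity of the finite sums, then the expansion in falling factorials at each node.
        expand : ∀ n → ℚC.Σ< M (λ m → ℚC.S m k ℚ.* leftSum (g m) n) ≡ leftSum (λ q → (σ ℚ.* q) ^ℚ k) n
        expand n = ≡.trans
          (ℚC.Σ<-cong M {λ m → ℚC.S m k ℚ.* leftSum (g m) n} {λ m → leftSum (λ q → ℚC.S m k ℚ.* g m q) n}
             (λ m _ → ≡.sym (leftSum-*ˡ (ℚC.S m k) (g m) n)))
          (≡.trans (≡.sym (leftSum-Σ< M (λ m q → ℚC.S m k ℚ.* g m q) n))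
            (leftSum-cong (λ q → ≡.trans
               (ℚC.Σ<-cong M {λ m → ℚC.S m k ℚ.* g m q} {λ m → g m q ℚ.* ℚC.S m k} λ m _ → ℚ.*-comm (ℚC.S m k) (g m q))
               (ℚC.^-as-falling (σ ℚ.* q) k M k<M)) n))

      -- The case M = 1, k = 0 of `moments`: the only summand is `a 0 * S 0 0`, and `μ 0` computes
      -- to `ι 1ℚ`.
      a₀ : a 0 ≈ 1#
      a₀ = begin
        a 0                      ≈⟨ *-identityʳ (a 0) ⟨
        a 0 * 1#                 ≈⟨ *-congˡ nat-one ⟨
        a 0 * S 0 0              ≈⟨ +-identityʳ _ ⟨
        a 0 * S 0 0 + 0#         ≈⟨ moments 1 0 (ℕ.s≤s ℕ.z≤n) ⟩
        μ 0                      ≈⟨ ι-one ⟩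
        1#                       ∎

      -- The series and the power `w` enter as opaque terms with equations describing them, so that
      -- the real statement can be supplied as it stands.
      formula : ∀ b x z (egf-b egf-exp1-1 X′ egf-exp : Sequence) → (x ⊕ ι y) ≋ z →
        (∀ n → egf-b n ≋ (b n ⊗ ι (recipℚ (n !) {{n ℕ.!≢0}}))) →
        (∀ n → egf-exp1-1 n ≋ (expm1 n ⊗ ι (recipℚ (n !) {{n ℕ.!≢0}}))) →
        (∀ n → X′ n ≋ (X n ⊗ ι (recipℚ (n !) {{n ℕ.!≢0}}))) →
        (∀ n → egf-exp n ≋ (pow x n ⊗ ι (recipℚ (n !) {{n ℕ.!≢0}}))) →
        (∀ n → conv egf-b egf-exp1-1 n ≋ conv X′ egf-exp n) →
        ∀ n → 1 ℕ.≤ n → ∀ w → w ≋ (z ^ n) →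
        b n ≋ sub w (fromℕ n ⊗ sum₁ n (λ m → div (a m) m ⊗ gS (n ∸ 1) (m ∸ 1) x))
      formula b x z β f v ξ x+y≈z β≈ f≈ v≈ ξ≈ hyp (suc n) _ w w≈ = begin
        b (suc n)                         ≈⟨ +-identityʳ _ ⟨
        b (suc n) + 0#                    ≈⟨ +-congˡ (-‿inverseʳ T) ⟨
        b (suc n) + (T - T)               ≈⟨ +-assoc _ _ _ ⟨
        (b (suc n) + T) - T               ≈⟨ +-congʳ (BernoulliSequence.bernoulli-stirling b x bernoulli μ (ι y) moment a n
                                               (λ k k≤ → moments (suc (suc n)) k (ℕ.s≤s k≤)) a₀) ⟩
        (x + ι y) ^ suc n - T             ≈⟨ +-cong (trans (^-congˡ (suc n) x+y≈z) (sym w≈)) (-‿cong T≈) ⟩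
        w - _                             ≈⟨ sub≈ _ _ ⟨
        _                                 ∎
        where
        gS≈Σ< : ∀ i → gS n i x ≈ Σ< (suc (n ∸ i)) (λ j → nat ((n C j) ℕ.* stirling₂ (n ∸ j) i) * x ^ j)
        gS≈Σ< i = trans (gS≈ n i x)
          (trans (sum₀≈ (n ∸ i) (λ j → fromℕ ((n C j) ℕ.* stirling₂ (n ∸ j) i) * pow x j))
          (Σ<-cong (suc (n ∸ i)) λ j _ → *-cong (fromℕ≈ ((n C j) ℕ.* stirling₂ (n ∸ j) i)) (pow≈ x j)))
        conv≈Σ< : ∀ f g n → conv f g n ≈ Σ< (suc n) (λ i → f i * g (n ∸ i))
        conv≈Σ< f g n = trans (conv≈ f g n) (sum₀≈ n (λ i → f i * g (n ∸ i)))
        T = nat (suc n) * Σ< (suc n) (λ i → (a (suc i) * recip (suc i)) * ((x ^_) ⋆ S i) n)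
        T≈ : T ≈ fromℕ (suc n) * sum₁ (suc n) (λ m → div (a m) m * gS n (m ∸ 1) x)
        T≈ = *-cong (sym (fromℕ≈ (suc n))) (trans
          (Σ<-cong (suc n) λ i i< → *-cong (sym (div≈ (a (suc i)) (suc i)))
            (trans (^-⋆-S x (ℕ.s≤s⁻¹ i<)) (sym (gS≈Σ< i))))
          (sym (sum₁≈ (suc n) (λ m → div (a m) m * gS n (m ∸ 1) x))))
        bernoulli : b ⋆ expm1 ≐ X ⋆ (x ^_)
        bernoulli n = egf-injective (b ⋆ expm1) (X ⋆ (x ^_)) n (begin
          egf (b ⋆ expm1) n                                      ≈⟨ egf-⋆ b expm1 n ⟨
          Σ< (suc n) (λ i → egf b i * egf expm1 (n ∸ i))         ≈⟨ Σ<-cong (suc n) (λ i _ → *-cong (β≈ i) (f≈ (n ∸ i))) ⟨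
          Σ< (suc n) (λ i → β i * f (n ∸ i))                     ≈⟨ conv≈Σ< β f n ⟨
          conv β f n                                             ≈⟨ hyp n ⟩
          conv v ξ n                                             ≈⟨ conv≈Σ< v ξ n ⟩
          Σ< (suc n) (λ i → v i * ξ (n ∸ i))                     ≈⟨ Σ<-cong (suc n) (λ i _ → *-cong (v≈ i)
                                                                      (trans (ξ≈ (n ∸ i)) (*-congʳ (pow≈ x (n ∸ i))))) ⟩
          Σ< (suc n) (λ i → egf X i * egf (x ^_) (n ∸ i))        ≈⟨ egf-⋆ X (x ^_) n ⟩
          egf (X ⋆ (x ^_)) n                                     ∎)

open import Defs

-- Real limits of rational sequences

infix 4 _⇝_
-- Convergence is tested along the diagonal, `r n` against the n-th approximation of x; for a Cauchy
-- sequence this amounts to ordinary convergence.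
record _⇝_ (r : ℕ → ℚ) (x : ℝ) : Set where
  constructor mk⇝
  field
    error-null : Null (λ n → r n ℚ.- seq x n)

open _⇝_

module _ where
  open +-*-Solver

  ⇝-unique : ∀ {r x y} → r ⇝ x → r ⇝ y → x ≈ y
  ⇝-unique {r} {x} {y} p q = mk≈ (null-resp
    (λ n → solve 3 (λ r x y → (:- (r :- x)) :+ (r :- y) := x :- y) ≡.refl (r n) (seq x n) (seq y n))
    (null-+ (null-neg (error-null p)) (error-null q)))

  ⇝-resp-≈ : ∀ {r x y} → x ≈ y → r ⇝ x → r ⇝ y
  ⇝-resp-≈ {r} {x} {y} p q = mk⇝ (null-resp
    (λ n → solve 3 (λ r x y → (r :- x) :+ (x :- y) := r :- y) ≡.refl (r n) (seq x n) (seq y n))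
    (null-+ (error-null q) (null p)))

  ⇝-resp-≗ : ∀ {r s x} → (∀ n → r n ≡ s n) → r ⇝ x → s ⇝ x
  ⇝-resp-≗ {x = x} r≗s p = mk⇝ (null-resp (λ n → ≡.cong (ℚ._- seq x n) (r≗s n)) (error-null p))

  ⇝-const : ∀ q → (λ _ → q) ⇝ fromℚ q
  ⇝-const q = mk⇝ (null-0 (λ _ → ℚ.+-inverseʳ q))

  ⇝-+ : ∀ {r s x y} → r ⇝ x → s ⇝ y → (λ n → r n ℚ.+ s n) ⇝ x + y
  ⇝-+ {r} {s} {x} {y} p q = mk⇝ (null-resp
    (λ n → solve 4 (λ r x s y → (r :- x) :+ (s :- y) := (r :+ s) :- (x :+ y)) ≡.refl (r n) (seq x n) (s n) (seq y n))
    (null-+ (error-null p) (error-null q)))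

  ⇝-*ˡ : ∀ q {r x} → r ⇝ x → (λ n → q ℚ.* r n) ⇝ fromℚ q * x
  ⇝-*ˡ q {r} {x} p = mk⇝ (null-resp
    (λ n → solve 3 (λ q r x → q :* (r :- x) := q :* r :- q :* x) ≡.refl q (r n) (seq x n))
    (null-* (bounded (fromℚ q)) (error-null p)))

-- Integrals over [0, 1]

fromℚ-mono : ∀ {p q} → p ℚ.≤ q → fromℚ p ≤ fromℚ q
fromℚ-mono {p} {q} p≤q ε 0<ε = 0 , λ _ _ →
  ≡.subst (ℚ._≤ q ℚ.+ ε) (ℚ.+-identityʳ p) (ℚ.+-mono-≤ p≤q (ℚ.<⇒≤ 0<ε))

uniform-step : ∀ n i → natℚ (suc i) ℚ.* recipℚ (suc n) ℚ.- natℚ i ℚ.* recipℚ (suc n) ≡ recipℚ (suc n)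
uniform-step n i = ≡.trans
  (≡.cong (λ q → q ℚ.* h ℚ.- natℚ i ℚ.* h) (natℚ-suc i))
  (solve 2 (λ i h → (con 1ℚ :+ i) :* h :- i :* h := h) ≡.refl (natℚ i) h)
  where
  open +-*-Solver
  h = recipℚ (suc n)

-- All points are constant sequences, which makes the Riemann sums constant sequences too.
uniform : ℕ → TaggedPartition 0ℝ 1ℝ
uniform n = record
  { size  = suc n
  ; point = λ i → node (toℕ i)
  ; tag   = λ i → node (toℕ i)
  ; start = ≡⇒≈ (λ _ → ℚ.*-zeroˡ (recipℚ (suc n)))
  ; end   = ≡⇒≈ (λ _ → ≡.trans (≡.cong (λ i → natℚ i ℚ.* recipℚ (suc n)) (toℕ-fromℕ (suc n))) (recipℚ-inverse (suc n)))
  ; lower = λ i → fromℚ-mono (ℚ.≤-reflexive (≡.cong (λ i → natℚ i ℚ.* recipℚ (suc n)) (toℕ-inject₁ i)))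
  ; upper = λ i → fromℚ-mono (ℚ.*-monoʳ-≤-nonNeg (recipℚ (suc n)) {{ℚ.nonNegative (ℚ.<⇒≤ (recipℚ-pos (suc n)))}}
      (natℚ-mono (ℕ.n≤1+n (toℕ i))))
  }
  where
  node : ℕ → ℝ
  node i = fromℚ (natℚ i ℚ.* recipℚ (suc n))

uniform-width : ∀ n i k → seq (width (uniform n) i) k ≡ recipℚ (suc n)
uniform-width n i k = ≡.trans
  (≡.cong (λ j → natℚ (suc (toℕ i)) ℚ.* recipℚ (suc n) ℚ.- natℚ j ℚ.* recipℚ (suc n)) (toℕ-inject₁ i))
  (uniform-step n (toℕ i))

uniform-mesh : ∀ n {δ} → recipℚ (suc n) ℚ.≤ δ → MeshAtMost (uniform n) δ
uniform-mesh n {δ} h≤δ i ε 0<ε = 0 , λ k _ → begin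
  seq (width (uniform n) i) k   ≡⟨ uniform-width n i k ⟩
  recipℚ (suc n)                ≤⟨ h≤δ ⟩
  δ                             ≡⟨ ℚ.+-identityʳ δ ⟨
  δ ℚ.+ 0ℚ                      ≤⟨ ℚ.+-monoʳ-≤ δ (ℚ.<⇒≤ 0<ε) ⟩
  δ ℚ.+ ε                       ∎
  where open ℚ.≤-Reasoning

seq-sum : ∀ {n} (x : Fin n → ℝ) k → seq (sum x) k ≡ ℚSum.sum (λ i → seq (x i) k)
seq-sum {zero}  x k = ≡.refl
seq-sum {suc n} x k = ≡.cong (seq (x zero) k ℚ.+_) (seq-sum (x ∘ suc) k)

riemannSum-uniform : ∀ f g → (∀ q k → seq (f (fromℚ q)) k ≡ g q) →
                     ∀ n k → seq (riemannSum (uniform n) f) k ≡ leftSum g n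
riemannSum-uniform f g f≡g n k = ≡.trans
  (seq-sum (λ i → f (tag (uniform n) i) * width (uniform n) i) k)
  (ℚSum.sum-cong-≗ λ i → ≡.cong₂ ℚ._*_ (f≡g (natℚ (toℕ i) ℚ.* recipℚ (suc n)) k) (uniform-width n i k))

-- The slack η comes from the order on ℝ, which compares approximations only eventually and up to
-- every positive rational.
close-to-rational : ∀ {s x q ε} → (∀ k → seq s k ≡ q) → ∣ s - x ∣ ≤ fromℚ ε → ∀ η → 0ℚ ℚ.< η →
  ∃[ M ] (∀ k → M ℕ.≤ k → ℚ.∣ q ℚ.- seq x k ∣ ℚ.≤ ε ℚ.+ η)
close-to-rational {s} {x} {q} {ε} s≡q s-x≤ε η 0<η = proj₁ (s-x≤ε η 0<η) , λ k k≥ →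
  ≡.subst (λ p → ℚ.∣ p ℚ.- seq x k ∣ ℚ.≤ ε ℚ.+ η) (s≡q k) (proj₂ (s-x≤ε η 0<η) k k≥)

half-pos : ∀ {ε} → 0ℚ ℚ.< ε → 0ℚ ℚ.< ½ ℚ.* ε
half-pos {ε} 0<ε = ≡.subst (ℚ._< ½ ℚ.* ε) (ℚ.*-zeroʳ ½) (ℚ.*-monoʳ-<-pos ½ 0<ε)

leftSum⇝integral : ∀ f g {I} → (∀ q k → seq (f (fromℚ q)) k ≡ g q) → IsIntegral 0ℝ 1ℝ f I → leftSum g ⇝ I
leftSum⇝integral f g {I} f≡g int = mk⇝ λ ε 0<ε → proj₁ (within ε 0<ε) , proj₂ (within ε 0<ε)
  where
  module _ (ε : ℚ) (0<ε : 0ℚ ℚ.< ε) where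
    h η : ℚ
    h = ½ ℚ.* ε
    η = ½ ℚ.* h
    0<h = half-pos 0<ε
    0<η = half-pos 0<h
    δ = proj₁ (int h 0<h)
    0<δ = proj₁ (proj₂ (int h 0<h))
    K = cauchy I η 0<η
    D = recipℚ-small δ 0<δ
    L = leftSum g
    within : ∃[ N ] (∀ n → N ℕ.≤ n → ℚ.∣ L n ℚ.- seq I n ∣ ℚ.≤ ε)
    within = proj₁ K ℕ.⊔ proj₁ D , λ n n≥ →
      let mesh = proj₂ D n (ℕ.≤-trans (ℕ.m≤n⊔m (proj₁ K) (proj₁ D)) n≥)
          E = close-to-rational {riemannSum (uniform n) f} {I} {L n} {h} (riemannSum-uniform f g f≡g n)
                (proj₂ (proj₂ (int h 0<h)) (uniform n) (uniform-mesh n mesh)) η 0<η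
          -- The estimate E starts at an index depending on n, so it is used at a later k and the
          -- Cauchy property of I leads back to n. The error splits as ε/2 for the integral, ε/4 for
          -- the order and ε/4 for this return.
          k = proj₁ E ℕ.⊔ proj₁ K
      in begin
      ℚ.∣ L n ℚ.- seq I n ∣
        ≡⟨ ≡.cong ℚ.∣_∣ (solve 3 (λ l i j → l :- i := (l :- j) :+ (j :- i)) ≡.refl (L n) (seq I n) (seq I k)) ⟩
      ℚ.∣ (L n ℚ.- seq I k) ℚ.+ (seq I k ℚ.- seq I n) ∣
        ≤⟨ ℚ.∣p+q∣≤∣p∣+∣q∣ (L n ℚ.- seq I k) (seq I k ℚ.- seq I n) ⟩
      ℚ.∣ L n ℚ.- seq I k ∣ ℚ.+ ℚ.∣ seq I k ℚ.- seq I n ∣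
        ≤⟨ ℚ.+-mono-≤ (proj₂ E k (ℕ.m≤m⊔n (proj₁ E) (proj₁ K)))
             (proj₂ K k n (ℕ.m≤n⊔m (proj₁ E) (proj₁ K)) (ℕ.≤-trans (ℕ.m≤m⊔n (proj₁ K) (proj₁ D)) n≥)) ⟩
      (h ℚ.+ η) ℚ.+ η
        ≡⟨ solve 1 (λ ε → (con ½ :* ε :+ con ½ :* (con ½ :* ε)) :+ con ½ :* (con ½ :* ε) := ε) ≡.refl ε ⟩
      ε
        ∎
      where
      open ℚ.≤-Reasoning
      open +-*-Solver

-- Cauchy numbers as limits, and the instance at ℝ

seq-^ : ∀ x n k → seq (x ^ n) k ≡ seq x k ^ℚ n
seq-^ x zero    k = ≡.refl
seq-^ x (suc n) k = ≡.cong (seq x k ℚ.*_) (seq-^ x n k)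

seq-falling : ∀ x n k → seq (falling x n) k ≡ ℚC.falling (seq x k) n
seq-falling x zero    k = ≡.refl
seq-falling x (suc n) k = ≡.cong (ℚ._* (seq x k ℚ.- natℚ n)) (seq-falling x n k)

scaledBinomial : ℚ → ℕ → ℚ → ℚ
scaledBinomial σ m q = recipℚ (m !) {{m ℕ.!≢0}} ℚ.* ℚC.falling (σ ℚ.* q) m

seq-binomial : ∀ x σ q m → (∀ k → seq x k ≡ σ ℚ.* q) → ∀ k → seq (binomial x m) k ≡ scaledBinomial σ m q
seq-binomial x σ q m x≡ k = ≡.trans
  (≡.cong (ℚ._* r) (≡.trans (seq-falling x m k) (≡.cong (λ z → ℚC.falling z m) (x≡ k))))
  (ℚ.*-comm (ℚC.falling (σ ℚ.* q) m) r)
  where r = recipℚ (m !) {{m ℕ.!≢0}}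

module ℝFormulas = CauchyNumberFormulas +-*-isCommutativeRing fromℚ
  (≡⇒≈ λ _ → ≡.refl) (≡⇒≈ λ _ → ≡.refl)
  (λ _ _ → ≡⇒≈ λ _ → ≡.refl) (λ _ _ → ≡⇒≈ λ _ → ≡.refl)
  _⇝_ ⇝-unique ⇝-resp-≗ mk⇝ (⇝-const 0ℚ) ⇝-+ ⇝-*ˡ

-- The factor m! of the Cauchy number cancels the denominator of the binomial, leaving bare falling
-- factorials.
leftSum⇝cauchyNumber : ∀ {f σ m I c} → (∀ q k → seq (f (fromℚ q)) k ≡ scaledBinomial σ m q) →
  IsIntegral 0ℝ 1ℝ f I → c ≈ fromNat (m !) * I → leftSum (λ q → ℚC.falling (σ ℚ.* q) m) ⇝ c
leftSum⇝cauchyNumber {f} {σ} {m} {I} {c} f≡ int c≈ =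
  ⇝-resp-≈ {leftSum g} {fromNat (m !) * I} {c} (IsEquivalence.sym ≈-isEquivalence c≈)
    (⇝-resp-≗ {x = fromNat (m !) * I}
      (λ n → ≡.trans (≡.sym (leftSum-*ˡ (natℚ (m !)) (scaledBinomial σ m) n)) (leftSum-cong unscale n))
      (⇝-*ˡ (natℚ (m !)) {leftSum (scaledBinomial σ m)} {I} (leftSum⇝integral f (scaledBinomial σ m) {I} f≡ int)))
  where
  g : ℚ → ℚ
  g q = ℚC.falling (σ ℚ.* q) m
  instance m!≢0 = m ℕ.!≢0
  unscale : ∀ q → natℚ (m !) ℚ.* scaledBinomial σ m q ≡ g q
  unscale q = ≡.trans (≡.sym (ℚ.*-assoc (natℚ (m !)) (recipℚ (m !)) (g q)))
    (≡.trans (≡.cong (ℚ._* g q) (recipℚ-inverse (m !))) (ℚ.*-identityˡ (g q)))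

seq-^ᴿ : ∀ x n k → seq (x ℝFormulas.^ n) k ≡ seq x k ^ℚ n
seq-^ᴿ x zero    k = ≡.refl
seq-^ᴿ x (suc n) k = ≡.cong (seq x k ℚ.*_) (seq-^ᴿ x n k)

-- The power is spelled out as it occurs in the unfolded body of
-- generalizedStirling₂, so that the two sides are equal syntactically and
-- no Cauchy moduli have to be compared.
module ℝStatement = ℝFormulas.Statement
  (RawSemiring._^_ (SemiringWithoutAnnihilatingZero.rawSemiring (Semiring.semiringWithoutAnnihilatingZero
    (CommutativeSemiring.semiring (CommutativeRing.commutativeSemiring +-*-commutativeRing)))))
  (λ x n → ≡⇒≈ λ k → ≡.trans (seq-^ x n k) (≡.sym (seq-^ᴿ x n k)))
  fromNat (λ _ → ≡⇒≈ λ _ → ≡.refl)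
  _-_ (λ _ _ → ≡⇒≈ λ _ → ≡.refl)
  (λ n f → ∑[ i ≤ n ] f (toℕ i)) (λ _ _ → ≡⇒≈ λ _ → ≡.refl)
  Σ₁ (λ _ _ → ≡⇒≈ λ _ → ≡.refl)
  _⊛_ (λ _ _ _ → ≡⇒≈ λ _ → ≡.refl)
  generalizedStirling₂ (λ _ _ _ → ≡⇒≈ λ _ → ≡.refl)
  _/_ (λ _ _ → ≡⇒≈ λ _ → ≡.refl)

expm1-egf : ∀ n → (exp 1ℝ ⊖ one) n ≈ ℝFormulas.expm1 n * fromℚ (recipℚ (n !) {{n ℕ.!≢0}})
expm1-egf zero    = ≡⇒≈ (λ _ → ≡.refl)
expm1-egf (suc n) = ≡⇒≈ λ k →
  ≡.trans (ℚ.+-identityʳ (seq (1ℝ ^ suc n) k ℚ.* r))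
    (≡.cong (ℚ._* r) (≡.trans (seq-^ 1ℝ (suc n) k) (1^ℚ (suc n))))
  where r = recipℚ (suc n !) {{suc n ℕ.!≢0}}

var-egf : ∀ n → var n ≈ ℝFormulas.X n * fromℚ (recipℚ (n !) {{n ℕ.!≢0}})
var-egf 0             = ≡⇒≈ (λ _ → ≡.refl)
var-egf 1             = ≡⇒≈ (λ _ → ≡.refl)
var-egf (suc (suc n)) = ≡⇒≈ λ _ →
  ≡.sym (ℚ.*-zeroˡ (recipℚ (suc (suc n) !) {{suc (suc n) ℕ.!≢0}}))

σ-y₁ : ∀ n → 1ℚ ^ℚ n ℚ.+ 0ℚ ^ℚ suc n ≡ (0ℚ ℚ.+ 1ℚ) ^ℚ suc n
σ-y₁ n = ≡.trans (≡.cong (1ℚ ^ℚ n ℚ.+_) (ℚ.*-zeroˡ (0ℚ ^ℚ n)))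
  (≡.trans (ℚ.+-identityʳ (1ℚ ^ℚ n)) (≡.sym (ℚ.*-identityˡ (1ℚ ^ℚ n))))

-- The reflection of t to 1 - t carries -t to -1 + t, whence σ = y = -1; both sides are 0.
σ-y₂ : ∀ n → (ℚ.- 1ℚ) ^ℚ n ℚ.+ (ℚ.- 1ℚ) ^ℚ suc n ≡ (ℚ.- 1ℚ ℚ.+ 1ℚ) ^ℚ suc n
σ-y₂ n = ≡.trans (solve 1 (λ p → p :+ con (ℚ.- 1ℚ) :* p := con 0ℚ) ≡.refl ((ℚ.- 1ℚ) ^ℚ n))
  (≡.sym (ℚ.*-zeroˡ (0ℚ ^ℚ n)))
  where open +-*-Solver

theorem8 : (c ĉ : ℕ → ℝ) → AreCauchyNumbers₁ c → AreCauchyNumbers₂ ĉ →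
    (B : ℕ → ℝ → ℝ) → AreBernoulliPolynomials B →
    (n : ℕ) → 1 ℕ.≤ n → (x : ℝ) →
    (B n x ≈ x ^ n - fromNat n * (∑[1≤ m ≤ n ] (c m / m * generalizedStirling₂ (n ∸ 1) (m ∸ 1) x)))
    ×
    (B n x ≈ (x - 1ℝ) ^ n - fromNat n * (∑[1≤ m ≤ n ] (ĉ m / m * generalizedStirling₂ (n ∸ 1) (m ∸ 1) x)))
theorem8 c ĉ c-cauchy ĉ-cauchy B B-bernoulli n 1≤n x =
  First.formula (λ k → B k x) x x (egf (λ k → B k x)) (exp 1ℝ ⊖ one) var (exp x)
    (≡⇒≈ λ k → ℚ.+-identityʳ (seq x k)) (λ _ → ≡⇒≈ λ _ → ≡.refl) expm1-egf var-egf (λ _ → ≡⇒≈ λ _ → ≡.refl) (B-bernoulli x) n 1≤n (x ^ n)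
    (≡⇒≈ λ k → ≡.trans (seq-^ x n k) (≡.sym (seq-^ᴿ x n k))) ,
  Second.formula (λ k → B k x) x (x - 1ℝ) (egf (λ k → B k x)) (exp 1ℝ ⊖ one) var (exp x)
    (≡⇒≈ λ _ → ≡.refl) (λ _ → ≡⇒≈ λ _ → ≡.refl) expm1-egf var-egf (λ _ → ≡⇒≈ λ _ → ≡.refl) (B-bernoulli x) n 1≤n ((x - 1ℝ) ^ n)
    (≡⇒≈ λ k → ≡.trans (seq-^ (x - 1ℝ) n k) (≡.sym (seq-^ᴿ (x - 1ℝ) n k)))
  where
  open +-*-Solver using (solve; _:*_; _:=_; :-_; con)
  module First = ℝStatement.Formula 1ℚ 0ℚ σ-y₁ c (λ m →
    leftSum⇝cauchyNumber {λ t → binomial t m} {1ℚ} {m} {proj₁ (c-cauchy m)} {c m}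
      (λ q → seq-binomial (fromℚ q) 1ℚ q m (λ _ → ≡.sym (ℚ.*-identityˡ q)))
      (proj₁ (proj₂ (c-cauchy m))) (proj₂ (proj₂ (c-cauchy m))))
  module Second = ℝStatement.Formula (ℚ.- 1ℚ) (ℚ.- 1ℚ) σ-y₂ ĉ (λ m →
    leftSum⇝cauchyNumber {λ t → binomial (- t) m} {ℚ.- 1ℚ} {m} {proj₁ (ĉ-cauchy m)} {ĉ m}
      (λ q → seq-binomial (- fromℚ q) (ℚ.- 1ℚ) q m (λ _ → solve 1 (λ q → :- q := con (ℚ.- 1ℚ) :* q) ≡.refl q))
      (proj₁ (proj₂ (ĉ-cauchy m))) (proj₂ (proj₂ (ĉ-cauchy m))))
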